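{- Consider any adaptive adversary (injection strategy together with an answering entity $\mathrm{ADV}$) playing against the algorithm MIX-R in the problem of buffer management with bounded delay. Let $N\ge 1$ be the maximum, over all steps (of all plays of the game that can occur), of the number of packets that MIX-R assigns positive transmission probability in a step. Then $$\mathbb{E}[\mathcal{G}_{\text{MIX-R}}(I)]\ \ge\ \Bigl(1-\bigl(1-\tfrac1N\bigr)^N\Bigr)\cdot \mathbb{E}[\mathcal{G}_{\mathrm{ADV}}(I)],$$ where $I$ is the (random) instance created by the adversary. That is, MIX-R is $1/\bigl(1-(1-\frac1N)^N\bigr)$-competitive against an adaptive adversary.
   Context: **Problem (buffer management with bounded delay).** Time is divided into unit steps; step $t$ corresponds to the interval $(t,t+1)$. A packet is $(w,d)$ with weight $w>0$ and relative deadline $d$ (a positive integer at injection), the number of steps after which it expires; distinct packets may have equal weight and deadline. Buffers are initially empty. Before each step any finite set of packets may be injected, into both the algorithm's and $\mathrm{ADV}$'s buffers. In step $t$ the algorithm and $\mathrm{ADV}$ independently each choose and transmit at most one packet from their own buffer; a transmitted packet is removed from the buffer of the party that transmitted it. At time $t+1$ the relative deadlines of all remaining packets are decremented by $1$, packets whose relative deadline reaches $0$ expire and are removed from both buffers, and then the adversary injects any finite set of packets and step $t+1$ begins. A packet is pending for a party if it has been released and has neither expired nor been transmitted by that party. The gain $\mathcal{G}_X(I)$ of $X$ on instance $I$ (the sequence of injected packets) is the total weight of packets transmitted by $X$. **Adaptive(-online) adversary.** The packets injected at a given time may depend on the algorithm's (random) behavior up to that time. The adversary also provides an answering entity $\mathrm{ADV}$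 that creates its own solution in parallel with the algorithm and cannot change it afterwards: its transmission in step $t$ is chosen without knowledge of the algorithm's random choice in step $t$ or later. $\mathrm{ADV}$ is deterministic (without loss of generality), but since the algorithm is randomized, so is $I$. An algorithm $\mathrm{ALG}$ is $R$-competitive against an adaptive adversary if for any adaptively created instance $I$ and any answering entity $\mathrm{ADV}$, $\mathbb{E}[\mathcal{G}_{\mathrm{ALG}}(I)]\ge \frac1R\,\mathbb{E}[\mathcal{G}_{\mathrm{ADV}}(I)]$ (no additive constant). **Dominance.** A pending packet $a=(w_a,d_a)$ is dominated by a pending packet $b=(w_b,d_b)$ if $w_a\le w_b$ and $d_a\ge d_b$; it is strictly dominated by $b$ if moreover one of these inequalities is strict. A packet is (strictly) dominated if some pending packet (strictly) dominates it. **Algorithm MIX-R (one step).** If there are no pending packets, do nothing. Otherwise set $m\leftarrow 0$, $n\leftarrow 0$, $r\leftarrow 1$, $H_0\leftarrow$ the set of packets pending for the algorithm, and $h_0=(w_0,d_0)\leftarrow$ a heaviest packet of $H_0$. While $H_m\neq\emptyset$, do: 1. $m\leftarrow m+1$; 2. $h_m=(w_m,d_m)\leftarrow$ a heaviest not strictly dominated packet from $H_{m-1}$; 3. $p_{m-1}\leftarrow\min\{1-\frac{w_m}{w_{m-1}},\,r\}$; 4. $r\leftarrow r-p_{m-1}$; 5. if $r>0$ then $n\leftarrow n+1$; 6. $H_m\leftarrow\{x\in H_{m-1} : x\text{ is not dominated by }h_m\}$. After the loop set $p_m\leftarrow r$. Transmit a packet chosen (with fresh randomness) from $h_1,\dots,h_n$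 with probability distribution $p_1,\dots,p_n$. (Always $p_0=0$.) The number of packets assigned positive probability in the step is the final value of $n$. -}

module Defs where

open import Algebra.Bundles using (CommutativeRing)
open import Algebra.Structures using (IsCommutativeRing)
import Algebra.Construct.NaturalChoice.Min as Min
import Algebra.Properties.Semiring.Exp as Exp
import Algebra.Properties.Semiring.Mult as Mult
open import Data.Bool.Base using (if_then_else_)
open import Data.Fin.Base using (Fin)
open import Data.List.Base
  using (List; []; _∷_; _++_; allFin; concatMap; drop; filter; foldr; length; lookup; map; mapMaybe; removeAt; take)
open import Data.List.Membership.Propositional using (_∈_)
open import Data.Maybe.Base using (Maybe; just; nothing; maybe)
open import Data.Nat.Base as ℕ using (ℕ; zero; suc)
import Data.Nat.Properties as ℕ
open import Data.Product.Base using (∃; _×_; _,_)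
open import Data.Sum.Base using (_⊎_)
open import Level using (Level; _⊔_) renaming (suc to lsuc)
open import Relation.Binary.Bundles using (DecTotalOrder)
open import Relation.Binary.Core using (Rel)
import Relation.Binary.Construct.NonStrictToStrict as ToStrict
open import Relation.Binary.Definitions using (Decidable)
open import Relation.Binary.PropositionalEquality.Core using (_≡_)
open import Relation.Binary.Structures using (IsDecTotalOrder)
open import Relation.Nullary using (¬_; does; ¬?; _×-dec_)

-- Weights, probabilities and gains are taken in an arbitrary linearly ordered
-- field, since the library has no real numbers; classically ℝ is an instance.
record OrderedField (c ℓ₁ ℓ₂ : Level) : Set (lsuc (c ⊔ ℓ₁ ⊔ ℓ₂)) where
  infix  8 -_ _⁻¹
  infixl 7 _*_
  infixl 6 _+_
  infix  4 _≈_ _≤_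
  field
    Carrier           : Set c
    _≈_               : Rel Carrier ℓ₁
    _≤_               : Rel Carrier ℓ₂
    _+_ _*_           : Carrier → Carrier → Carrier
    -_ _⁻¹            : Carrier → Carrier
    0# 1#             : Carrier
    isCommutativeRing : IsCommutativeRing _≈_ _+_ _*_ -_ 0# 1#
    isDecTotalOrder   : IsDecTotalOrder _≈_ _≤_
    0≉1               : ¬ (0# ≈ 1#)
    *-inverseʳ        : ∀ x → ¬ (x ≈ 0#) → x * x ⁻¹ ≈ 1#
    +-monoˡ-≤         : ∀ z {x y} → x ≤ y → x + z ≤ y + z
    *-nonNegative     : ∀ {x y} → 0# ≤ x → 0# ≤ y → 0# ≤ x * y

  commutativeRing : CommutativeRing c ℓ₁
  commutativeRing = record { isCommutativeRing = isCommutativeRing }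

  decTotalOrder : DecTotalOrder c ℓ₁ ℓ₂
  decTotalOrder = record { isDecTotalOrder = isDecTotalOrder }

  open CommutativeRing commutativeRing public using (semiring; _-_)
  open DecTotalOrder decTotalOrder public using (totalOrder; _≟_; _≤?_)
  open ToStrict _≈_ _≤_ public using (_<_)
  open Min totalOrder public using (_⊓_)
  open Exp semiring public using (_^_)

  infixl 7 _/_
  _/_ : Carrier → Carrier → Carrier
  x / y = x * y ⁻¹

  infix 4 _<?_
  _<?_ : Decidable _<_
  _<?_ = ToStrict.<-decidable _≈_ _≤_ _≟_ _≤?_

  fromℕ : ℕ → Carrier
  fromℕ n = Mult._×_ semiring n 1#

module Game {c ℓ₁ ℓ₂ : Level} (F : OrderedField c ℓ₁ ℓ₂) where

  open OrderedField F

  record Packet : Set (c ⊔ ℓ₁ ⊔ ℓ₂) where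
    constructor packet
    field
      weight     : Carrier
      deadline   : ℕ
      0<weight   : 0# < weight
      0<deadline : 0 ℕ.< deadline

  -- Packets in a buffer are identified by their positions, so that distinct
  -- packets may have equal weight and deadline.
  Buffer : Set (c ⊔ ℓ₁ ⊔ ℓ₂)
  Buffer = List Packet

  age : Packet → Maybe Packet
  age (packet w (suc (suc d)) 0<w _) = just (packet w (suc d) 0<w (ℕ.s≤s ℕ.z≤n))
  age _                              = nothing

  Transmission : Buffer → Set
  Transmission B = Maybe (Fin (length B))

  transmittedWeight : (B : Buffer) → Transmission B → Carrier
  transmittedWeight B = maybe (λ i → Packet.weight (lookup B i)) 0#

  remove : (B : Buffer) → Transmission B → Buffer
  remove B = maybe (removeAt B) B

  module MIXR (B : Buffer) where

    w : Fin (length B) → Carrier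
    w i = Packet.weight (lookup B i)

    d : Fin (length B) → ℕ
    d i = Packet.deadline (lookup B i)

    Dominated : Rel (Fin (length B)) ℓ₂
    Dominated a b = w a ≤ w b × d b ℕ.≤ d a

    StrictlyDominated : Rel (Fin (length B)) (ℓ₁ ⊔ ℓ₂)
    StrictlyDominated a b = Dominated a b × (w a < w b ⊎ d b ℕ.< d a)

    dominated? : Decidable Dominated
    dominated? a b = w a ≤? w b ×-dec d b ℕ.≤? d a

    Heaviest : ∀ {ℓ} → (Fin (length B) → Set ℓ) → Fin (length B) → Set (ℓ₂ ⊔ ℓ)
    Heaviest P h = P h × (∀ x → P x → w x ≤ w h)

    NotStrictlyDominatedIn : List (Fin (length B)) → Fin (length B) → Set (ℓ₁ ⊔ ℓ₂)
    NotStrictlyDominatedIn H x = x ∈ H × ¬ ∃ (StrictlyDominated x)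

    -- The executions of the while loop from its test onwards, with H = Hₘ,
    -- h = hₘ and the current r.  There may be several, because a heaviest
    -- packet need not be unique.
    data Loop : List (Fin (length B)) → Fin (length B) → Carrier → Set (c ⊔ ℓ₁ ⊔ ℓ₂) where
      done : ∀ {h r} → Loop [] h r
      step : ∀ {H h r} (h′ : Fin (length B)) →
             Heaviest (NotStrictlyDominatedIn H) h′ →
             Loop (filter (λ x → ¬? (dominated? x h′)) H) h′ (r - (1# - w h′ / w h) ⊓ r) →
             Loop H h r

    -- (hₘ , pₘ) , (hₘ₊₁ , pₘ₊₁) , … up to the end of the loop, where the
    -- remaining r becomes the last probability.
    assigned : ∀ {H h r} → Loop H h r → List (Fin (length B) × Carrier)
    assigned {h = h} {r} done           = (h , r) ∷ []
    assigned {h = h} {r} (step h′ _ ex) = (h , (1# - w h′ / w h) ⊓ r) ∷ assigned ex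

    -- The number of increments of n still to come.
    increments : ∀ {H h r} → Loop H h r → ℕ
    increments                 done           = 0
    increments {h = h} {r = r} (step h′ _ ex) =
      if does (0# <? (r - (1# - w h′ / w h) ⊓ r)) then suc (increments ex) else increments ex

  data Step : Buffer → Set (c ⊔ ℓ₁ ⊔ ℓ₂) where
    idle : Step []
    run  : ∀ {B} (h₀ : Fin (length B)) →
           MIXR.Heaviest B (_∈ allFin (length B)) h₀ →
           MIXR.Loop B (allFin (length B)) h₀ 1# →
           Step B

  finalN : ∀ {B} → Step B → ℕ
  finalN     idle         = 0
  finalN {B} (run _ _ ex) = MIXR.increments B ex

  -- Finitely supported distributions, as lists of outcomes with probabilities.
  Dist : ∀ {a} → Set a → Set (a ⊔ c)
  Dist A = List (A × Carrier)

  𝔼 : ∀ {a} {A : Set a} → (A → Carrier) → Dist A → Carrier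
  𝔼 X = foldr (λ (a , p) acc → p * X a + acc) 0#

  -- h₁ , … , hₙ with p₁ , … , pₙ; the entry of h₀ is dropped.
  transmission : ∀ {B} → Step B → Dist (Transmission B)
  transmission     idle           = (nothing , 1#) ∷ []
  transmission {B} s@(run _ _ ex) =
    map (λ (h , p) → just h , p) (take (finalN s) (drop 1 (MIXR.assigned B ex)))

  -- What the algorithm did in one step.
  record Turn : Set (c ⊔ ℓ₁ ⊔ ℓ₂) where
    field
      buffer      : Buffer
      transmitted : Transmission buffer

  -- The turns of the past steps, latest first.
  History : Set (c ⊔ ℓ₁ ⊔ ℓ₂)
  History = List Turn

  -- An implementation of MIX-R: ties between heaviest packets may be broken in
  -- any way, even depending on the past.
  MIX-R : Set (c ⊔ ℓ₁ ⊔ ℓ₂)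
  MIX-R = History → (B : Buffer) → Step B

  -- Both components see the algorithm's random choices of past steps only.
  -- ADV's own buffer is determined by the history; it is passed to `answer`
  -- only so that ADV transmits a packet pending for it.
  record Adversary : Set (c ⊔ ℓ₁ ⊔ ℓ₂) where
    field
      inject : History → List Packet
      answer : History → (B : Buffer) → Transmission B

  -- The situation at the beginning of a step, after the injection.
  record State : Set (c ⊔ ℓ₁ ⊔ ℓ₂) where
    field
      history         : History
      algBuffer       : Buffer
      advBuffer       : Buffer
      algGain advGain : Carrier

  module Play (mixR : MIX-R) (adversary : Adversary) where

    open Adversary adversary
    open State

    initial : State
    initial = record
      { history   = []
      ; algBuffer = inject []
      ; advBuffer = inject []
      ; algGain   = 0#
      ; advGain   = 0#
      }

    algStep : (s : State) → Step (algBuffer s)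
    algStep s = mixR (history s) (algBuffer s)

    next : (s : State) → Transmission (algBuffer s) → State
    next s x = record
      { history   = past
      ; algBuffer = mapMaybe age (remove (algBuffer s) x) ++ inject past
      ; advBuffer = mapMaybe age (remove (advBuffer s) y) ++ inject past
      ; algGain   = algGain s + transmittedWeight (algBuffer s) x
      ; advGain   = advGain s + transmittedWeight (advBuffer s) y
      }
      where
      y : Transmission (advBuffer s)
      y = answer (history s) (advBuffer s)
      past : History
      past = record { buffer = algBuffer s ; transmitted = x } ∷ history s

    -- The distribution of the state after t steps.
    play : ℕ → Dist State
    play zero    = (initial , 1#) ∷ []
    play (suc t) = concatMap
      (λ (s , p) → map (λ (x , q) → next s x , p * q) (transmission (algStep s)))
      (play t)

    -- The state s can occur at the beginning of step t.
    Occurs : ℕ → State → Set (c ⊔ ℓ₁ ⊔ ℓ₂)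
    Occurs t s = ∃ λ p → (s , p) ∈ play t × 0# < p

    IsMaxN : ℕ → Set (c ⊔ ℓ₁ ⊔ ℓ₂)
    IsMaxN N = (∃ λ t → ∃ λ s → Occurs t s × finalN (algStep s) ≡ N)
             × (∀ t s → Occurs t s → finalN (algStep s) ℕ.≤ N)

    -- Expected gains in the first t steps.
    𝔼algGain 𝔼advGain : ℕ → Carrier
    𝔼algGain t = 𝔼 algGain (play t)
    𝔼advGain t = 𝔼 advGain (play t)

  -- f ≤sup g means sup f ≤ sup g, where a supremum may be infinite: every upper
  -- bound of g bounds f.  Plays need not end and transmitted weights are
  -- positive, so an expected total gain is the supremum over t of the expected
  -- gain in the first t steps; for plays that end, it is the eventual value.
  infix 4 _≤sup_
  _≤sup_ : (ℕ → Carrier) → (ℕ → Carrier) → Set (c ⊔ ℓ₂)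
  f ≤sup g = ∀ u → (∀ t → g t ≤ u) → ∀ t → f t ≤ u

{-# OPTIONS --safe #-}

-- Couple the two buffers: each packet of ADV is matched with at most one packet
-- of MIX-R, which must not expire earlier, and ADV is credited in advance with
-- the excess of its packet's weight over that of the partner.  When ADV
-- transmits, the partner k of its packet becomes free; when MIX-R transmits f,
-- the ADV packet matched with f is rematched with k if f expires no later than
-- k, and is credited with w f otherwise.  Hence a step costs at most
-- max (w k) (w f) in the first case and w k + w f in the second.  Let z be the
-- first index such that h_z dominates k.  The expected cost is at most
-- w z + Σ_{i<z} pᵢ wᵢ ≤ w₁, because pᵢ wᵢ ≤ wᵢ - wᵢ₊₁ telescopes, whereas the
-- expected gain of MIX-R equals w₁ (1 - Π (1 - pᵢ)), which by AM-GM is at least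
-- w₁ (1 - (1 - 1/N)^N).
module Submission where

open import Defs
open import Algebra.Bundles using (CommutativeRing)
open import Algebra.Bundles.Raw using (RawRing)
import Algebra.Construct.NaturalChoice.Max as Max
import Algebra.Construct.NaturalChoice.MaxOp as MaxOp
import Algebra.Construct.NaturalChoice.Min as Min
import Algebra.Construct.NaturalChoice.MinOp as MinOp
import Algebra.Properties.Ring as RingProperties
import Algebra.Properties.Semiring.Exp as Exp
import Algebra.Properties.Semiring.Mult.TCOptimised as Mult′
import Algebra.Solver.Ring as RingSolver
open import Algebra.Solver.Ring.AlmostCommutativeRing using (_-Raw-AlmostCommutative⟶_; fromCommutativeRing)
open import Data.Bool.Base using (if_then_else_)
open import Data.Fin.Base using (Fin; zero; suc)
open import Data.Fin.Properties using (any?)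
open import Data.Integer.Base as ℤ using (ℤ; +_; -[1+_]; _⊖_)
import Data.Integer.Properties as ℤ
open import Data.List.Base
  using (List; []; _∷_; _++_; allFin; catMaybes; concatMap; drop; filter; foldr; length; lookup; map; mapMaybe;
         removeAt; take)
open import Data.List.Membership.Propositional using (_∈_)
open import Data.List.Membership.Propositional.Properties using (∈-allFin; ∈-filter⁺; ∈-filter⁻; ∈-map⁺)
open import Data.List.Properties
  using (concatMap-cong; concatMap-map; length-map; length-take; map-concatMap; map-∘; mapMaybe-cong;
         mapMaybe-++; mapMaybe-map; mapMaybe-map-retract)
open import Data.List.Relation.Binary.Permutation.Propositional as ↭
  using (_↭_; prep; swap; ↭-refl; ↭-reflexive; ↭-sym; ↭-trans)
open import Data.List.Relation.Binary.Permutation.Propositional.Properties using (drop-∷; mapMaybe-↭; ++⁺ʳ; ∈-resp-↭)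
open import Data.List.Relation.Unary.All as All using (All; []; _∷_)
import Data.List.Relation.Unary.All.Properties as All
open import Data.List.Relation.Unary.Any using (here; index; there)
open import Data.List.Relation.Unary.Any.Properties using (lookup-index)
open import Data.Maybe.Base using (Maybe; just; maybe; nothing; _>>=_)
open import Data.Nat.Base as ℕ using (ℕ; suc; zero)
open import Data.Nat.Induction using (<-wellFounded)
import Data.Nat.Properties as ℕ
open import Data.Product.Base using (∃; ∃₂; _×_; _,_; proj₁; proj₂)
import Data.Sign.Base as Sign
open import Data.Sum.Base using (_⊎_; inj₁; inj₂)
open import Data.Unit.Base using (⊤; tt)
open import Function.Base using (_∘_)
open import Induction.WellFounded using (Acc; acc)
open import Level using (_⊔_)
open import Relation.Binary.Bundles using (DecTotalOrder)
open import Relation.Binary.PropositionalEquality.Core as ≡ using (_≡_)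
import Relation.Binary.Reasoning.PartialOrder as ≤-Reasoning
import Relation.Binary.Reasoning.Setoid as ≈-Reasoning
open import Relation.Nullary using (¬_; contradiction; no; yes; ¬?; does; _×-dec_; _⊎-dec_)

-- Arithmetic in an ordered field and Bernoulli's inequality.

module OrderedFieldProperties {c ℓ₁ ℓ₂} (F : OrderedField c ℓ₁ ℓ₂) where

  open OrderedField F
  open CommutativeRing commutativeRing public
    using (refl; sym; trans; reflexive; setoid; ring;
           +-cong; +-congˡ; +-congʳ; *-cong; *-congˡ; *-congʳ; -‿cong;
           +-assoc; +-comm; +-identityˡ; +-identityʳ; *-identityˡ; *-identityʳ; zeroˡ; zeroʳ; *-comm; -‿inverseʳ)
  open DecTotalOrder decTotalOrder public
    using (antisym; total; poset)
    renaming (refl to ≤-refl; trans to ≤-trans; reflexive to ≤-reflexive; ≤-respˡ-≈ to ≤-respˡ; ≤-respʳ-≈ to ≤-respʳ)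
  open Max totalOrder using () renaming (_⊔_ to _∨_)
  open MinOp (Min.minOperator totalOrder) public using (x⊓y≤x; x⊓y≤y; ⊓-glb; ⊓-sel)
  open MaxOp (Max.maxOperator totalOrder) using (x≤x⊔y; x≤y⊔x; ⊔-lub)

  private
    module ×′ = Mult′ semiring
    open ×′ using () renaming (_×_ to _×′_)
    open RingProperties ring

    -- Coefficients in ℤ, whose equality computes, let the solver cancel terms.
    ⟦_⟧ : ℤ → Carrier
    ⟦ + n ⟧      = n ×′ 1#
    ⟦ -[1+ n ] ⟧ = - (suc n ×′ 1#)

    ⟦⊖⟧ : ∀ m n → ⟦ m ⊖ n ⟧ ≈ m ×′ 1# - n ×′ 1#
    ⟦⊖⟧ zero    zero    = sym (-‿inverseʳ 0#)
    ⟦⊖⟧ zero    (suc n) = sym (+-identityˡ _)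
    ⟦⊖⟧ (suc m) zero    = sym (trans (+-congˡ -0#≈0#) (+-identityʳ _))
    ⟦⊖⟧ (suc m) (suc n) = begin
      ⟦ suc m ⊖ suc n ⟧                    ≡⟨ ≡.cong ⟦_⟧ (ℤ.[1+m]⊖[1+n]≡m⊖n m n) ⟩
      ⟦ m ⊖ n ⟧                            ≈⟨ ⟦⊖⟧ m n ⟩
      m ×′ 1# - n ×′ 1#                    ≈⟨ cancel ⟨
      (1# + m ×′ 1#) - (1# + n ×′ 1#)      ≈⟨ +-cong (×′.×-homo-+ 1# 1 m) (-‿cong (×′.×-homo-+ 1# 1 n)) ⟨
      suc m ×′ 1# - suc n ×′ 1#            ∎
      where
      open ≈-Reasoning setoid
      a = m ×′ 1#
      b = n ×′ 1#
      cancel : (1# + a) - (1# + b) ≈ a - b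
      cancel = begin
        (1# + a) - (1# + b)        ≈⟨ +-congˡ (-‿+-comm 1# b) ⟨
        (1# + a) + (- 1# - b)      ≈⟨ +-congʳ (+-comm 1# a) ⟩
        (a + 1#) + (- 1# - b)      ≈⟨ +-assoc _ _ _ ⟩
        a + (1# + (- 1# - b))      ≈⟨ +-congˡ (+-assoc _ _ _) ⟨
        a + ((1# - 1#) - b)        ≈⟨ +-congˡ (+-congʳ (-‿inverseʳ 1#)) ⟩
        a + (0# - b)               ≈⟨ +-congˡ (+-identityˡ _) ⟩
        a - b                      ∎

    ⟦-⟧ : ∀ i → ⟦ ℤ.- i ⟧ ≈ - ⟦ i ⟧
    ⟦-⟧ (+ zero)  = sym -0#≈0#
    ⟦-⟧ (+ suc n) = refl
    ⟦-⟧ -[1+ n ]  = sym (-‿involutive _)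

    ⟦+⟧ : ∀ i j → ⟦ i ℤ.+ j ⟧ ≈ ⟦ i ⟧ + ⟦ j ⟧
    ⟦+⟧ (+ m)    (+ n)    = ×′.×-homo-+ 1# m n
    ⟦+⟧ (+ m)    -[1+ n ] = ⟦⊖⟧ m (suc n)
    ⟦+⟧ -[1+ m ] (+ n)    = trans (⟦⊖⟧ n (suc m)) (+-comm _ _)
    ⟦+⟧ -[1+ m ] -[1+ n ] = begin
      - (suc (suc (m ℕ.+ n)) ×′ 1#)           ≡⟨ ≡.cong (λ k → - (suc k ×′ 1#)) (≡.sym (ℕ.+-suc m n)) ⟩
      - ((suc m ℕ.+ suc n) ×′ 1#)             ≈⟨ -‿cong (×′.×-homo-+ 1# (suc m) (suc n)) ⟩
      - (suc m ×′ 1# + suc n ×′ 1#)           ≈⟨ -‿+-comm _ _ ⟨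
      - (suc m ×′ 1#) - suc n ×′ 1#           ∎
      where open ≈-Reasoning setoid

    ⟦-◃⟧ : ∀ n → ⟦ Sign.- ℤ.◃ n ⟧ ≈ - (n ×′ 1#)
    ⟦-◃⟧ n = trans (reflexive (≡.cong ⟦_⟧ (ℤ.-◃n≡-n n))) (⟦-⟧ (+ n))

    ⟦*⟧ : ∀ i j → ⟦ i ℤ.* j ⟧ ≈ ⟦ i ⟧ * ⟦ j ⟧
    ⟦*⟧ (+ m)    (+ n)    = trans (reflexive (≡.cong ⟦_⟧ (ℤ.+◃n≡+n (m ℕ.* n)))) (×′.×1-homo-* m n)
    ⟦*⟧ (+ m)    -[1+ n ] = trans (⟦-◃⟧ (m ℕ.* suc n)) (trans (-‿cong (×′.×1-homo-* m (suc n))) (-‿distribʳ-* _ _))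
    ⟦*⟧ -[1+ m ] (+ n)    = trans (⟦-◃⟧ (suc m ℕ.* n)) (trans (-‿cong (×′.×1-homo-* (suc m) n)) (-‿distribˡ-* _ _))
    ⟦*⟧ -[1+ m ] -[1+ n ] = begin
      (suc m ℕ.* suc n) ×′ 1#                 ≈⟨ ×′.×1-homo-* (suc m) (suc n) ⟩
      suc m ×′ 1# * suc n ×′ 1#               ≈⟨ -‿involutive _ ⟨
      - - (suc m ×′ 1# * suc n ×′ 1#)         ≈⟨ -‿cong (-‿distribʳ-* _ _) ⟩
      - (suc m ×′ 1# * - (suc n ×′ 1#))       ≈⟨ -‿distribˡ-* _ _ ⟩
      - (suc m ×′ 1#) * - (suc n ×′ 1#)       ∎
      where open ≈-Reasoning setoid

    ℤ-rawRing : RawRing _ _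
    ℤ-rawRing = record { _≈_ = _≡_ ; _+_ = ℤ._+_ ; _*_ = ℤ._*_ ; -_ = ℤ.-_ ; 0# = ℤ.0ℤ ; 1# = ℤ.1ℤ }

    morphism : ℤ-rawRing -Raw-AlmostCommutative⟶ fromCommutativeRing commutativeRing
    morphism = record
      { ⟦_⟧ = ⟦_⟧ ; +-homo = ⟦+⟧ ; *-homo = ⟦*⟧ ; -‿homo = ⟦-⟧ ; 0-homo = refl ; 1-homo = refl }

    _≟ᶜ_ : ∀ i j → Maybe (⟦ i ⟧ ≈ ⟦ j ⟧)
    i ≟ᶜ j with i ℤ.≟ j
    ... | yes ≡.refl = just refl
    ... | no  _      = nothing

  module Solver = RingSolver ℤ-rawRing (fromCommutativeRing commutativeRing) morphism _≟ᶜ_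
  open Solver

  :1 : ∀ {n} → Polynomial n
  :1 = con (+ 1)

  :0 : ∀ {n} → Polynomial n
  :0 = con (+ 0)

  0≤y-x⇒x≤y : ∀ {x y} → 0# ≤ y - x → x ≤ y
  0≤y-x⇒x≤y {x} {y} 0≤y-x = ≤-respˡ (+-identityˡ x)
    (≤-respʳ (solve 2 (λ x y → (y :- x) :+ x := y) refl x y) (+-monoˡ-≤ x 0≤y-x))

  x≤y⇒0≤y-x : ∀ {x y} → x ≤ y → 0# ≤ y - x
  x≤y⇒0≤y-x {x} {y} x≤y = ≤-respˡ (-‿inverseʳ x) (+-monoˡ-≤ (- x) x≤y)

  -- The standard way to prove an inequality below: exhibit the difference as an expression `e` that
  -- is visibly nonnegative, and leave the identity to the ring solver.
  ≤-by : ∀ {x y e} → 0# ≤ e → y - x ≈ e → x ≤ y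
  ≤-by 0≤e y-x≈e = 0≤y-x⇒x≤y (≤-respʳ (sym y-x≈e) 0≤e)

  +-mono-≤ : ∀ {x y u v} → x ≤ y → u ≤ v → x + u ≤ y + v
  +-mono-≤ {x} {y} {u} {v} x≤y u≤v = ≤-trans (+-monoˡ-≤ u x≤y)
    (≤-by (x≤y⇒0≤y-x u≤v) (solve 3 (λ y u v → (y :+ v) :- (y :+ u) := v :- u) refl y u v))

  +-nonNegative : ∀ {x y} → 0# ≤ x → 0# ≤ y → 0# ≤ x + y
  +-nonNegative 0≤x 0≤y = ≤-respˡ (+-identityˡ 0#) (+-mono-≤ 0≤x 0≤y)

  *-monoˡ-≤ : ∀ {z x y} → 0# ≤ z → x ≤ y → z * x ≤ z * y
  *-monoˡ-≤ {z} {x} {y} 0≤z x≤y = ≤-by (*-nonNegative 0≤z (x≤y⇒0≤y-x x≤y))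
    (solve 3 (λ x y z → z :* y :- z :* x := z :* (y :- x)) refl x y z)

  *-mono-≤ : ∀ {x y u v} → 0# ≤ u → 0# ≤ y → x ≤ y → u ≤ v → x * u ≤ y * v
  *-mono-≤ {x} {y} {u} {v} 0≤u 0≤y x≤y u≤v = ≤-trans
    (≤-respˡ (*-comm u x) (≤-respʳ (*-comm u y) (*-monoˡ-≤ 0≤u x≤y))) (*-monoˡ-≤ 0≤y u≤v)

  0≤1 : 0# ≤ 1#
  0≤1 with total 0# 1#
  ... | inj₁ 0≤1 = 0≤1
  ... | inj₂ 1≤0 = ≤-respʳ (solve 0 ((:0 :- :1) :* (:0 :- :1) := :1) refl)
                     (*-nonNegative (x≤y⇒0≤y-x 1≤0) (x≤y⇒0≤y-x 1≤0))

  1≰0 : ¬ (1# ≤ 0#)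
  1≰0 1≤0 = 0≉1 (antisym 0≤1 1≤0)

  ⁻¹-nonNegative : ∀ {x} → 0# < x → 0# ≤ x ⁻¹
  ⁻¹-nonNegative {x} (0≤x , 0≉x) with total 0# (x ⁻¹)
  ... | inj₁ 0≤x⁻¹ = 0≤x⁻¹
  ... | inj₂ x⁻¹≤0 = contradiction (≤-by (*-nonNegative 0≤x (x≤y⇒0≤y-x x⁻¹≤0)) eq) 1≰0
    where
    eq : 0# - 1# ≈ x * (0# - x ⁻¹)
    eq = trans (+-congˡ (-‿cong (sym (*-inverseʳ x (λ x≈0 → 0≉x (sym x≈0))))))
      (solve 2 (λ x y → :0 :- x :* y := x :* (:0 :- y)) refl x (x ⁻¹))

  x/y*y≈x : ∀ x {y} → ¬ (y ≈ 0#) → (x / y) * y ≈ x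
  x/y*y≈x x {y} y≉0 = trans (solve 3 (λ x y z → x :* z :* y := x :* (y :* z)) refl x y (y ⁻¹))
    (trans (*-congˡ (*-inverseʳ y y≉0)) (*-identityʳ x))

  /-nonNegative : ∀ {x y} → 0# ≤ x → 0# < y → 0# ≤ x / y
  /-nonNegative 0≤x 0<y = *-nonNegative 0≤x (⁻¹-nonNegative 0<y)

  x≤y⇒x/y≤1 : ∀ {x y} → 0# < y → x ≤ y → x / y ≤ 1#
  x≤y⇒x/y≤1 {x} {y} 0<y@(_ , 0≉y) x≤y = ≤-by (*-nonNegative (⁻¹-nonNegative 0<y) (x≤y⇒0≤y-x x≤y))
    (trans (+-congʳ (sym (*-inverseʳ y (λ y≈0 → 0≉y (sym y≈0)))))
      (solve 3 (λ x y z → y :* z :- x :* z := z :* (y :- x)) refl x y (y ⁻¹)))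

  fromℕ-nonNegative : ∀ n → 0# ≤ fromℕ n
  fromℕ-nonNegative zero    = ≤-refl
  fromℕ-nonNegative (suc n) = +-nonNegative 0≤1 (fromℕ-nonNegative n)

  0<fromℕ-suc : ∀ n → 0# < fromℕ (suc n)
  0<fromℕ-suc n = fromℕ-nonNegative (suc n) , λ 0≈ → 1≰0 (≤-respʳ (sym 0≈)
    (≤-by (fromℕ-nonNegative n) (solve 1 (λ x → (:1 :+ x) :- :1 := x) refl (fromℕ n))))

  fromℕ-suc≉0 : ∀ n → ¬ (fromℕ (suc n) ≈ 0#)
  fromℕ-suc≉0 n ≈0 = proj₂ (0<fromℕ-suc n) (sym ≈0)

  ^-nonNegative : ∀ {x} n → 0# ≤ x → 0# ≤ x ^ n
  ^-nonNegative zero    0≤x = 0≤1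
  ^-nonNegative (suc n) 0≤x = *-nonNegative 0≤x (^-nonNegative n 0≤x)

  ^-≤1 : ∀ {x} n → 0# ≤ x → x ≤ 1# → x ^ n ≤ 1#
  ^-≤1 zero    0≤x x≤1 = ≤-refl
  ^-≤1 (suc n) 0≤x x≤1 = ≤-respʳ (*-identityˡ 1#) (*-mono-≤ (^-nonNegative n 0≤x) 0≤1 x≤1 (^-≤1 n 0≤x x≤1))

  -- Bernoulli's inequality for 1 + t/y, multiplied by the power of y so that y = 0 is allowed. The
  -- inductive step multiplies by y + t and discards the term (n + 1) yⁿ t².
  bernoulli : ∀ n {y t} → 0# ≤ y → 0# ≤ y + t → y ^ n * (y + fromℕ (suc n) * t) ≤ (y + t) ^ suc n
  bernoulli zero {y} {t} _ _ = ≤-reflexive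
    (solve 2 (λ y t → :1 :* (y :+ (:1 :+ :0) :* t) := (y :+ t) :* :1) refl y t)
  bernoulli (suc n) {y} {t} 0≤y 0≤y+t = ≤-trans
    (≤-by (*-nonNegative (^-nonNegative n 0≤y) (*-nonNegative (fromℕ-nonNegative (suc n)) 0≤t²))
      (solve 4 (λ y t z m → (y :+ t) :* (z :* (y :+ m :* t)) :- (y :* z) :* (y :+ (:1 :+ m) :* t)
                            := z :* (m :* (t :* t))) refl y t (y ^ n) (fromℕ (suc n))))
    (*-monoˡ-≤ 0≤y+t (bernoulli n 0≤y 0≤y+t))
    where
    0≤t² : 0# ≤ t * t
    0≤t² with total 0# t
    ... | inj₁ 0≤t = *-nonNegative 0≤t 0≤t
    ... | inj₂ t≤0 = ≤-respʳ (solve 1 (λ t → (:0 :- t) :* (:0 :- t) := t :* t) refl t)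
                       (*-nonNegative (x≤y⇒0≤y-x t≤0) (x≤y⇒0≤y-x t≤0))

  infix 9 _⁺
  _⁺ : Carrier → Carrier
  x ⁺ = x ∨ 0#

  x≤x⁺ : ∀ x → x ≤ x ⁺
  x≤x⁺ x = x≤x⊔y x 0#

  0≤x⁺ : ∀ x → 0# ≤ x ⁺
  0≤x⁺ x = x≤y⊔x x 0#

  ⁺-least : ∀ {x z} → x ≤ z → 0# ≤ z → x ⁺ ≤ z
  ⁺-least = ⊔-lub

  -- Serves to bound credits: an ADV packet of weight x whose partner changes from weight y to
  -- weight z gains at most `(y - z) ⁺` in credit.
  ⁺-triangle : ∀ x y z → (x - z) ⁺ ≤ (x - y) ⁺ + (y - z) ⁺
  ⁺-triangle x y z = ⁺-least
    (≤-respˡ (solve 3 (λ x y z → (x :- y) :+ (y :- z) := x :- z) refl x y z)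
      (+-mono-≤ (x≤x⁺ (x - y)) (x≤x⁺ (y - z))))
    (+-nonNegative (0≤x⁺ (x - y)) (0≤x⁺ (y - z)))

  -- Sums and products over lists of probabilities; AM-GM.

  Π1- : List Carrier → Carrier
  Π1- = foldr (λ p acc → (1# - p) * acc) 1#

  Σ : List Carrier → Carrier
  Σ = foldr _+_ 0#

  InUnitInterval : Carrier → Set _
  InUnitInterval p = 0# ≤ p × p ≤ 1#

  Σ≤length : ∀ {n ps} → length ps ℕ.≤ n → All InUnitInterval ps → Σ ps ≤ fromℕ n
  Σ≤length {n} ℕ.z≤n [] = fromℕ-nonNegative n
  Σ≤length (ℕ.s≤s len≤n) ((_ , p≤1) ∷ ps) = +-mono-≤ p≤1 (Σ≤length len≤n ps)

  Σ-nonNegative : ∀ {ps} → All InUnitInterval ps → 0# ≤ Σ ps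
  Σ-nonNegative []               = ≤-refl
  Σ-nonNegative ((0≤p , _) ∷ ps) = +-nonNegative 0≤p (Σ-nonNegative ps)

  -- The mean of `ps` padded with zeros to n entries. The multiplicative form makes sense for n = 0
  -- as well, where 0 is chosen.
  mean : ∀ n {ps} → length ps ℕ.≤ n → All InUnitInterval ps →
         ∃ λ a → fromℕ n * a ≈ Σ ps × InUnitInterval a
  mean zero    ℕ.z≤n [] = 0# , zeroʳ 0# , ≤-refl , 0≤1
  mean (suc n) {ps} len≤n ps∈ = Σ ps / fromℕ (suc n) ,
    trans (*-comm _ _) (x/y*y≈x (Σ ps) (fromℕ-suc≉0 n)) ,
    /-nonNegative (Σ-nonNegative ps∈) (0<fromℕ-suc n) ,
    x≤y⇒x/y≤1 (0<fromℕ-suc n) (Σ≤length len≤n ps∈)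

  *-cancel-fromℕ : ∀ n {x y} → fromℕ (suc n) * x ≈ fromℕ (suc n) * y → x ≈ y
  *-cancel-fromℕ n {x} {y} eq = trans (inv x) (trans (*-congʳ eq) (sym (inv y)))
    where
    inv : ∀ z → z ≈ fromℕ (suc n) * z * fromℕ (suc n) ⁻¹
    inv z = trans (sym (*-identityˡ z)) (trans (*-congʳ (sym (*-inverseʳ _ (fromℕ-suc≉0 n))))
      (solve 3 (λ m i z → m :* i :* z := m :* z :* i) refl (fromℕ (suc n)) (fromℕ (suc n) ⁻¹) z))

  1-^-cong : ∀ n {x y} → x ≈ y → (1# - x) ^ n ≈ (1# - y) ^ n
  1-^-cong n x≈y = Exp.^-congˡ semiring n (+-congˡ (-‿cong x≈y))

  -- AM-GM for the factors 1 - p and n - length ps further factors 1; passing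
  -- from n to n + 1 factors is Bernoulli's inequality.
  am-gm : ∀ n {ps a} → length ps ℕ.≤ n → All InUnitInterval ps → 0# ≤ 1# - a →
          fromℕ n * a ≈ Σ ps → Π1- ps ≤ (1# - a) ^ n
  am-gm zero    ℕ.z≤n [] _ _ = ≤-refl
  am-gm (suc n) {a = a} len≤n [] _ na≈0 = ≤-reflexive (sym (trans
    (1-^-cong (suc n) (*-cancel-fromℕ n (trans na≈0 (sym (zeroʳ _))))) (one (suc n))))
    where
    one : ∀ n → (1# - 0#) ^ n ≈ 1#
    one zero    = refl
    one (suc n) = trans (*-congˡ (one n)) (solve 0 ((:1 :- :0) :* :1 := :1) refl)
  am-gm (suc n) {p ∷ ps} {a} (ℕ.s≤s len≤n) ((0≤p , p≤1) ∷ ps∈) 0≤1-a na≈Σ with mean n len≤n ps∈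
  ... | b , nb≈Σ , 0≤b , b≤1 = begin
    (1# - p) * Π1- ps                                                  ≤⟨ *-monoˡ-≤ (x≤y⇒0≤y-x p≤1)
                                                                           (am-gm n len≤n ps∈ (x≤y⇒0≤y-x b≤1) nb≈Σ) ⟩
    (1# - p) * (1# - b) ^ n                                            ≈⟨ *-congʳ (sym mean-step) ⟩
    ((1# - b) + fromℕ (suc n) * (b - a)) * (1# - b) ^ n                ≈⟨ *-comm _ _ ⟩
    (1# - b) ^ n * ((1# - b) + fromℕ (suc n) * (b - a))                ≤⟨ bernoulli n (x≤y⇒0≤y-x b≤1)
                                                                           (≤-respʳ (sym b+[b-a]) 0≤1-a) ⟩
    ((1# - b) + (b - a)) ^ suc n                                       ≈⟨ Exp.^-congˡ semiring (suc n) b+[b-a] ⟩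
    (1# - a) ^ suc n                                                   ∎
    where
    open ≤-Reasoning poset
    b+[b-a] : (1# - b) + (b - a) ≈ 1# - a
    b+[b-a] = solve 2 (λ a b → (:1 :- b) :+ (b :- a) := :1 :- a) refl a b
    -- With a the mean of all entries and b that of the tail, (n + 1) a = p + n b. This turns 1 - p
    -- into the linear factor of Bernoulli's inequality at y = 1 - b and t = b - a.
    mean-step : (1# - b) + fromℕ (suc n) * (b - a) ≈ 1# - p
    mean-step = trans
      (solve 3 (λ a b m → (:1 :- b) :+ (:1 :+ m) :* (b :- a) := (:1 :+ m :* b) :- (:1 :+ m) :* a) refl a b (fromℕ n))
      (trans (+-cong (+-congˡ nb≈Σ) (-‿cong na≈Σ))
        (solve 2 (λ p s → (:1 :+ s) :- (p :+ s) := :1 :- p) refl p (Σ ps)))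

-- Finite distributions and their expectations.

module Expectation {c ℓ₁ ℓ₂} (F : OrderedField c ℓ₁ ℓ₂) where

  open OrderedField F
  open OrderedFieldProperties F
  open Solver
  open Game F using (Dist; 𝔼)

  module _ {a} {A : Set a} where

    mass : Dist A → Carrier
    mass = 𝔼 (λ _ → 1#)

    𝔼-cong : ∀ {X Y : A → Carrier} → (∀ x → X x ≈ Y x) → ∀ D → 𝔼 X D ≈ 𝔼 Y D
    𝔼-cong X≈Y []            = refl
    𝔼-cong X≈Y ((x , p) ∷ D) = +-cong (*-congˡ (X≈Y x)) (𝔼-cong X≈Y D)

    -- The comparison is demanded only at positive probability, because `IsMaxN` bounds n only at
    -- states that can occur.
    𝔼-mono : ∀ {X Y : A → Carrier} {D} →
             All (λ (x , p) → 0# ≤ p × (0# < p → X x ≤ Y x)) D → 𝔼 X D ≤ 𝔼 Y D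
    𝔼-mono []                                          = ≤-refl
    𝔼-mono {X} {Y} {(x , p) ∷ D} ((0≤p , X≤Y) ∷ X≤Ys) = +-mono-≤ pX≤pY (𝔼-mono X≤Ys)
      where
      pX≤pY : p * X x ≤ p * Y x
      pX≤pY with p ≟ 0#
      ... | yes p≈0 = ≤-reflexive (trans (trans (*-congʳ p≈0) (zeroˡ _)) (sym (trans (*-congʳ p≈0) (zeroˡ _))))
      ... | no  p≉0 = *-monoˡ-≤ 0≤p (X≤Y (0≤p , p≉0 ∘ sym))

    𝔼-+ : ∀ (X Y : A → Carrier) D → 𝔼 (λ x → X x + Y x) D ≈ 𝔼 X D + 𝔼 Y D
    𝔼-+ X Y []            = sym (+-identityˡ 0#)
    𝔼-+ X Y ((x , p) ∷ D) = trans (+-congˡ (𝔼-+ X Y D))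
      (solve 5 (λ p x y e f → p :* (x :+ y) :+ (e :+ f) := (p :* x :+ e) :+ (p :* y :+ f)) refl p (X x) (Y x) _ _)

    𝔼-* : ∀ k (X : A → Carrier) D → 𝔼 (λ x → k * X x) D ≈ k * 𝔼 X D
    𝔼-* k X []            = sym (zeroʳ k)
    𝔼-* k X ((x , p) ∷ D) = trans (+-congˡ (𝔼-* k X D))
      (solve 4 (λ p k x e → p :* (k :* x) :+ k :* e := k :* (p :* x :+ e)) refl p k (X x) _)

    𝔼-const : ∀ k D → 𝔼 (λ (_ : A) → k) D ≈ k * mass D
    𝔼-const k D = trans (𝔼-cong (λ _ → sym (*-identityʳ k)) D) (𝔼-* k (λ _ → 1#) D)

    𝔼-minus : ∀ (X Y : A → Carrier) k D → 𝔼 (λ x → X x - k * Y x) D ≈ 𝔼 X D - k * 𝔼 Y D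
    𝔼-minus X Y k D = trans (𝔼-+ X (λ x → - (k * Y x)) D) (+-congˡ
      (trans (𝔼-cong (λ x → solve 2 (λ k y → :- (k :* y) := (:- k) :* y) refl k (Y x)) D)
        (trans (𝔼-* (- k) Y D) (solve 2 (λ k y → (:- k) :* y := :- (k :* y)) refl k (𝔼 Y D)))))

    𝔼-++ : ∀ (X : A → Carrier) D E → 𝔼 X (D ++ E) ≈ 𝔼 X D + 𝔼 X E
    𝔼-++ X []            E = sym (+-identityˡ _)
    𝔼-++ X ((x , p) ∷ D) E = trans (+-congˡ (𝔼-++ X D E))
      (sym (+-assoc _ _ _))

    𝔼-null : ∀ (X : A → Carrier) {D} → All (λ (_ , p) → p ≈ 0#) D → 𝔼 X D ≈ 0#
    𝔼-null X []           = refl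
    𝔼-null X (p≈0 ∷ p≈0s) = trans (+-cong (trans (*-congʳ p≈0) (zeroˡ _)) (𝔼-null X p≈0s)) (+-identityˡ 0#)

    -- Undoes the truncation to h₁, ..., hₙ in `transmission`, so that the whole list of assigned
    -- probabilities can be treated by recursion on the loop.
    𝔼-take : ∀ (X : A → Carrier) n D → All (λ (_ , p) → p ≈ 0#) (drop n D) → 𝔼 X (take n D) ≈ 𝔼 X D
    𝔼-take X zero    D       p≈0s = sym (𝔼-null X p≈0s)
    𝔼-take X (suc n) []      p≈0s = refl
    𝔼-take X (suc n) (_ ∷ D) p≈0s = +-congˡ (𝔼-take X n D p≈0s)

    Π1-null : ∀ {D : Dist A} → All (λ (_ , p) → p ≈ 0#) D → Π1- (map proj₂ D) ≈ 1#
    Π1-null []           = refl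
    Π1-null (p≈0 ∷ p≈0s) = trans (*-cong (+-congˡ (-‿cong p≈0)) (Π1-null p≈0s))
      (solve 0 ((:1 :- :0) :* :1 := :1) refl)

    Π1-take : ∀ n (D : Dist A) → All (λ (_ , p) → p ≈ 0#) (drop n D) →
              Π1- (map proj₂ (take n D)) ≈ Π1- (map proj₂ D)
    Π1-take zero    D       p≈0s = sym (Π1-null p≈0s)
    Π1-take (suc n) []      p≈0s = refl
    Π1-take (suc n) (_ ∷ D) p≈0s = *-congˡ (Π1-take n D p≈0s)

    mass≈Σ : ∀ (D : Dist A) → mass D ≈ Σ (map proj₂ D)
    mass≈Σ []            = refl
    mass≈Σ ((_ , p) ∷ D) = +-cong (*-identityʳ p) (mass≈Σ D)

    mass-nonNegative : ∀ {D : Dist A} → All (λ (_ , p) → 0# ≤ p) D → 0# ≤ mass D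
    mass-nonNegative []           = ≤-refl
    mass-nonNegative (0≤p ∷ 0≤ps) = +-nonNegative (*-nonNegative 0≤p 0≤1) (mass-nonNegative 0≤ps)

    -- Applied with mass 0, where it makes every entry vanish, and with mass 1, where it puts every
    -- entry into the unit interval.
    probabilities≤mass : ∀ {D : Dist A} → All (λ (_ , p) → 0# ≤ p) D → All (λ (_ , p) → p ≤ mass D) D
    probabilities≤mass []                         = []
    probabilities≤mass {(_ , p) ∷ D} (0≤p ∷ 0≤ps) =
      ≤-by (mass-nonNegative 0≤ps) (solve 2 (λ p m → (p :* :1 :+ m) :- p := m) refl p (mass D)) ∷
      All.map (λ q≤ → ≤-trans q≤ (≤-by 0≤p (solve 2 (λ p m → (p :* :1 :+ m) :- m := p) refl p (mass D))))
        (probabilities≤mass 0≤ps)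

  module _ {a b} {A : Set a} {B : Set b} where

    𝔼-map : ∀ (X : B → Carrier) (f : A → B) D → 𝔼 X (map (λ (x , p) → f x , p) D) ≡ 𝔼 (X ∘ f) D
    𝔼-map X f []            = ≡.refl
    𝔼-map X f ((x , p) ∷ D) = ≡.cong (λ e → p * X (f x) + e) (𝔼-map X f D)

    𝔼-map-* : ∀ (X : B → Carrier) (f : A → B) p D →
              𝔼 X (map (λ (x , q) → f x , p * q) D) ≈ p * 𝔼 (X ∘ f) D
    𝔼-map-* X f p []            = sym (zeroʳ p)
    𝔼-map-* X f p ((x , q) ∷ D) = trans (+-congˡ (𝔼-map-* X f p D))
      (solve 4 (λ p q x e → p :* q :* x :+ p :* e := p :* (q :* x :+ e)) refl p q (X (f x)) _)

  module _ {a b c} {A : Set a} {B : A → Set b} {C : Set c} where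

    -- The tower rule for one round of play. The type of the second outcome depends on the first, as
    -- transmissions depend on the buffer.
    𝔼-bind : ∀ (X : C → Carrier) (f : ∀ x → B x → C) (K : ∀ x → Dist (B x)) D →
             𝔼 X (concatMap (λ (x , p) → map (λ (y , q) → f x y , p * q) (K x)) D)
             ≈ 𝔼 (λ x → 𝔼 (X ∘ f x) (K x)) D
    𝔼-bind X f K []            = refl
    𝔼-bind X f K ((x , p) ∷ D) = trans (𝔼-++ X (map (λ (y , q) → f x y , p * q) (K x)) _)
      (+-cong (𝔼-map-* X (f x) p (K x)) (𝔼-bind X f K D))

-- One step of MIX-R: probabilities, expected gain, expected cost.

module StepAnalysis {c ℓ₁ ℓ₂} (F : OrderedField c ℓ₁ ℓ₂) where

  open OrderedField F
  open OrderedFieldProperties F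
  open Expectation F
  open Solver
  open Game F

  module LoopProperties (B : Buffer) where

    open MIXR B

    0<w : ∀ i → 0# < w i
    0<w i = Packet.0<weight (lookup B i)

    Undominated : Fin (length B) → Set _
    Undominated x = ¬ ∃ (StrictlyDominated x)

    -- A strict dominator of a heaviest packet has the same weight and hence an earlier deadline, so
    -- descent along deadlines ends at an undominated packet.
    heaviest-undominated : ∀ x → (∀ y → w y ≤ w x) → ∃ λ y → Undominated y × w x ≤ w y
    heaviest-undominated x heaviest = go x heaviest (<-wellFounded (d x))
      where
      go : ∀ x → (∀ y → w y ≤ w x) → Acc ℕ._<_ (d x) → ∃ λ y → Undominated y × w x ≤ w y
      go x heaviest (acc rec) with any? (λ y → dominated? x y ×-dec (w x <? w y ⊎-dec d y ℕ.<? d x))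
      ... | no  undominated = x , undominated , ≤-refl
      ... | yes (y , _ , inj₁ (wx≤wy , wx≉wy)) = contradiction (antisym wx≤wy (heaviest y)) wx≉wy
      ... | yes (y , (wx≤wy , _) , inj₂ dy<dx)
        with z , undominated , wy≤wz ← go y (λ z → ≤-trans (heaviest z) wx≤wy) (rec dy<dx)
        = z , undominated , ≤-trans wx≤wy wy≤wz

    undominatedBy : Fin (length B) → List (Fin (length B)) → List (Fin (length B))
    undominatedBy h = filter (λ x → ¬? (dominated? x h))

    -- The loop invariant for Hₘ and hₘ, by which weights and deadlines both decrease weakly along
    -- h₁, h₂, ....
    Bounded : List (Fin (length B)) → Fin (length B) → Set _
    Bounded H h = ∀ {x} → NotStrictlyDominatedIn H x → w x ≤ w h × d x ℕ.≤ d h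

    -- Strict domination refers to the whole buffer, so a candidate left after filtering was one
    -- before and is no heavier than `h`. It then escapes domination by `h` only by expiring
    -- earlier.
    bounded-next : ∀ {H h} → Heaviest (NotStrictlyDominatedIn H) h → Bounded (undominatedBy h H) h
    bounded-next {H} {h} (_ , heaviest) {x} (x∈H′ , undominated)
      with x∈H , ¬dom ← ∈-filter⁻ (λ x → ¬? (dominated? x h)) {xs = H} x∈H′
      = wx≤wh , ℕ.<⇒≤ (ℕ.≰⇒> λ dh≤dx → ¬dom (wx≤wh , dh≤dx))
      where
      wx≤wh : w x ≤ w h
      wx≤wh = heaviest x (x∈H , undominated)

    module _ {h h′ r} (wh′≤wh : w h′ ≤ w h) (0≤r : 0# ≤ r) where

      private
        q = (1# - w h′ / w h) ⊓ r

      0≤q : 0# ≤ q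
      0≤q = ⊓-glb (x≤y⇒0≤y-x (x≤y⇒x/y≤1 (0<w h) wh′≤wh)) 0≤r

      -- The inequality that telescopes in `cost-pending`. It is strict only where `r` cuts the
      -- probability off.
      q*w≤ : q * w h ≤ w h - w h′
      q*w≤ = ≤-respˡ (*-comm (w h) q) (≤-respʳ eq (*-monoˡ-≤ (proj₁ (0<w h)) (x⊓y≤x (1# - w h′ / w h) r)))
        where
        eq : w h * (1# - w h′ / w h) ≈ w h - w h′
        eq = trans (solve 2 (λ h x → h :* (:1 :- x) := h :- x :* h) refl (w h) (w h′ / w h))
          (+-congˡ (-‿cong (x/y*y≈x (w h′) (proj₂ (0<w h) ∘ sym))))

    0≤r-q : ∀ p r → 0# ≤ r - p ⊓ r
    0≤r-q p r = x≤y⇒0≤y-x (x⊓y≤y p r)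

    assigned-mass : ∀ {H h r} (ex : Loop H h r) → mass (assigned ex) ≈ r
    assigned-mass {r = r} done            = solve 1 (λ r → r :* :1 :+ :0 := r) refl r
    assigned-mass {h = h} {r} (step h′ _ ex) = trans (+-congˡ (assigned-mass ex))
      (solve 2 (λ q r → q :* :1 :+ (r :- q) := r) refl ((1# - w h′ / w h) ⊓ r) r)

    assigned-bounds : ∀ {H h r} → Bounded H h → 0# ≤ r → (ex : Loop H h r) →
                      All (λ (i , p) → 0# ≤ p × w i ≤ w h × d i ℕ.≤ d h) (assigned ex)
    assigned-bounds bounded 0≤r done = (0≤r , ≤-refl , ℕ.≤-refl) ∷ []
    assigned-bounds {h = h} {r} bounded 0≤r (step h′ heaviest ex)
      with wh′≤wh , dh′≤dh ← bounded (proj₁ heaviest) =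
      (0≤q wh′≤wh 0≤r , ≤-refl , ℕ.≤-refl) ∷
      All.map (λ (0≤p , wi≤ , di≤) → 0≤p , ≤-trans wi≤ wh′≤wh , ℕ.≤-trans di≤ dh′≤dh)
        (assigned-bounds (bounded-next heaviest) (0≤r-q (1# - w h′ / w h) r) ex)

    assigned-null : ∀ {H h r} → Bounded H h → r ≈ 0# → (ex : Loop H h r) →
                    All (λ (_ , p) → p ≈ 0#) (assigned ex)
    assigned-null {r = r} bounded r≈0 ex = All.zipWith
      (λ ((0≤p , _) , p≤m) → antisym (≤-respʳ (trans (assigned-mass ex) r≈0) p≤m) 0≤p)
      (bounds , probabilities≤mass (All.map proj₁ bounds))
      where bounds = assigned-bounds bounded (≤-reflexive (sym r≈0)) ex

    -- As long as `r` does not cut q off, the next weight is (1 - q) times the current one, so the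
    -- recursion for the expected weight is that of the product. At a cut-off all later
    -- probabilities vanish and both sides equal q times `w h`.
    assigned-gain : ∀ {H h r} → Bounded H h → 0# ≤ r → (ex : Loop H h r) →
                    𝔼 w (assigned ex) ≈ w h * (1# - Π1- (map proj₂ (assigned ex)))
    assigned-gain {h = h} {r} bounded 0≤r done =
      solve 2 (λ h r → r :* h :+ :0 := h :* (:1 :- (:1 :- r) :* :1)) refl (w h) r
    assigned-gain {h = h} {r} bounded 0≤r (step h′ heaviest ex) =
      trans (+-congˡ (assigned-gain bounded′ (0≤r-q (1# - w h′ / w h) r) ex)) eq
      where
      q = (1# - w h′ / w h) ⊓ r
      Π = Π1- (map proj₂ (assigned ex))
      bounded′ = bounded-next heaviest
      eq : q * w h + w h′ * (1# - Π) ≈ w h * (1# - (1# - q) * Π)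
      eq with ⊓-sel (1# - w h′ / w h) r
      ... | inj₁ q≈1- = trans (+-congˡ (*-congʳ w′≈))
        (solve 3 (λ q h Π → q :* h :+ h :* (:1 :- q) :* (:1 :- Π) := h :* (:1 :- (:1 :- q) :* Π)) refl q (w h) Π)
        where
        w′≈ : w h′ ≈ w h * (1# - q)
        w′≈ = sym (trans (*-congˡ (+-congˡ (-‿cong q≈1-)))
          (trans (solve 2 (λ h x → h :* (:1 :- (:1 :- x)) := x :* h) refl (w h) (w h′ / w h))
            (x/y*y≈x (w h′) (proj₂ (0<w h) ∘ sym))))
      ... | inj₂ q≈r = trans (+-congˡ (*-congˡ (+-congˡ (-‿cong Π≈1))))
        (trans (solve 3 (λ q h k → q :* h :+ k :* (:1 :- :1) := h :* (:1 :- (:1 :- q) :* :1)) refl q (w h) (w h′))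
          (*-congˡ (+-congˡ (-‿cong (*-congˡ (sym Π≈1))))))
        where
        Π≈1 : Π ≈ 1#
        Π≈1 = Π1-null (assigned-null bounded′ (trans (+-congˡ (-‿cong q≈r)) (-‿inverseʳ r)) ex)

    -- Unlike `increments ex`, this includes the increment of n that belongs to h.
    positive : ∀ {H h r} → Loop H h r → ℕ
    positive {r = r} ex = if does (0# <? r) then suc (increments ex) else increments ex

    -- n stops growing once `r` is 0, and from then on only probability 0 is left to assign.
    assigned-drop : ∀ {H h r} → Bounded H h → 0# ≤ r → (ex : Loop H h r) →
                    All (λ (_ , p) → p ≈ 0#) (drop (positive ex) (assigned ex))
    -- The test `0# <? r` inside `positive` is composed of these two decisions.
    assigned-drop {r = r} bounded 0≤r ex with 0# ≤? r | 0# ≟ r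
    ... | no  0≰r | _       = contradiction 0≤r 0≰r
    ... | yes _   | yes 0≈r = All.drop⁺ (increments ex) (assigned-null bounded (sym 0≈r) ex)
    assigned-drop bounded 0≤r done | yes _ | no _ = []
    assigned-drop {h = h} {r} bounded 0≤r (step h′ heaviest ex) | yes _ | no _ =
      assigned-drop (bounded-next heaviest) (0≤r-q (1# - w h′ / w h) r) ex

    -- The cost of a step in which the adversary frees k and MIX-R transmits i.
    record IsCost (k : Fin (length B)) (C : Fin (length B) → Carrier) : Set (c ⊔ ℓ₂) where
      field
        ≤-sum : ∀ i → C i ≤ w i + w k
        ≤-max : ∀ i {v} → d i ℕ.≤ d k → w i ≤ v → w k ≤ v → C i ≤ v

    module _ {k C} (isCost : IsCost k C) where

      open IsCost isCost

      -- Deadlines decrease along the loop, so once `h` dominates `k` every packet from `h` on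
      -- expires no later than `k`. Then `≤-max` with v = `w h` bounds each cost, and the total mass
      -- is r.
      cost-dominated : ∀ {H h r} → Bounded H h → 0# ≤ r → (ex : Loop H h r) →
                       Dominated k h → 𝔼 C (assigned ex) ≤ w h * r
      cost-dominated {h = h} bounded 0≤r ex (wk≤wh , dh≤dk) = ≤-trans
        (𝔼-mono (All.map (λ {(i , _)} (0≤p , wi≤ , di≤) → 0≤p , λ _ → ≤-max i (ℕ.≤-trans di≤ dh≤dk) wi≤ wk≤wh)
          (assigned-bounds bounded 0≤r ex)))
        (≤-reflexive (trans (𝔼-const (w h) (assigned ex)) (*-congˡ (assigned-mass ex))))

      -- Since pᵢ wᵢ ≤ wᵢ - wᵢ₊₁, the sum over the packets before the one that
      -- dominates k telescopes.
      cost-pending : ∀ {H h r} → Bounded H h → 0# ≤ r → r ≤ 1# → (ex : Loop H h r) →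
                     k ∈ H → 𝔼 C (assigned ex) ≤ w h - (1# - r) * w k
      cost-pending {H} {h} {r} bounded 0≤r r≤1 (step h′ heaviest ex) k∈H =
        ≤-trans (+-mono-≤ qC≤ rest≤)
          (≤-reflexive (solve 5 (λ q h h′ k r → (h :- h′ :+ q :* k) :+ (h′ :- (:1 :- (r :- q)) :* k)
                                                := h :- (:1 :- r) :* k) refl q (w h) (w h′) (w k) r))
        where
        q = (1# - w h′ / w h) ⊓ r
        wh′≤wh = proj₁ (bounded (proj₁ heaviest))
        0≤q′ = 0≤q {h} {h′} wh′≤wh 0≤r
        0≤r-q′ = 0≤r-q (1# - w h′ / w h) r
        r-q≤1 : r - q ≤ 1#
        r-q≤1 = ≤-trans (≤-by 0≤q′ (solve 2 (λ q r → r :- (r :- q) := q) refl q r)) r≤1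
        qC≤ : q * C h ≤ w h - w h′ + q * w k
        qC≤ = ≤-trans (*-monoˡ-≤ 0≤q′ (≤-sum h))
          (≤-respˡ (solve 3 (λ q h k → q :* h :+ q :* k := q :* (h :+ k)) refl q (w h) (w k))
            (+-monoˡ-≤ (q * w k) (q*w≤ wh′≤wh 0≤r)))
        -- The probability spent before `h′` is 1 - (r - q), and each unit of it has been charged an
        -- extra `w k`, which the later packets must leave room for. If `h′` dominates `k`, the room
        -- comes from `w k` ≤ `w h′`.
        rest≤ : 𝔼 C (assigned ex) ≤ w h′ - (1# - (r - q)) * w k
        rest≤ with dominated? k h′
        ... | yes dom = ≤-trans (cost-dominated (bounded-next heaviest) 0≤r-q′ ex dom)
          (≤-by (*-nonNegative (x≤y⇒0≤y-x r-q≤1) (x≤y⇒0≤y-x (proj₁ dom)))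
            (solve 3 (λ s h k → (h :- (:1 :- s) :* k) :- h :* s := (:1 :- s) :* (h :- k)) refl (r - q) (w h′) (w k)))
        ... | no ¬dom = cost-pending (bounded-next heaviest) 0≤r-q′ r-q≤1 ex
                          (∈-filter⁺ (λ x → ¬? (dominated? x h′)) k∈H ¬dom)

    -- `transmission` leaves out the entry of h₀, so the analysis starts at h₁, where `r` is still 1
    -- because p₀ = 0. `covers` provides the two cases of the cost bound.
    record FirstIteration {H₀ h₀ r₀} (ex₀ : Loop H₀ h₀ r₀) : Set (c ⊔ ℓ₁ ⊔ ℓ₂) where
      field
        {H}         : List (Fin (length B))
        {h}         : Fin (length B)
        {r}         : Carrier
        ex          : Loop H h r
        r≈1         : r ≈ 1#
        bounded     : Bounded H h
        covers      : ∀ k → k ∈ H ⊎ Dominated k h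
        assigned≡   : drop 1 (assigned ex₀) ≡ assigned ex
        increments≡ : increments ex₀ ≡ positive ex

    firstIteration : ∀ {H₀ h₀} → (∀ i → i ∈ H₀) → Heaviest (_∈ H₀) h₀ → (ex₀ : Loop H₀ h₀ 1#) → FirstIteration ex₀
    firstIteration {h₀ = h₀} all∈ _ done with () ← all∈ h₀
    firstIteration {H₀} {h₀} all∈ (_ , heaviest₀) (step h heaviest ex) = record
      { ex          = ex
      ; r≈1         = r≈1
      ; bounded     = bounded-next heaviest
      ; covers      = covers
      ; assigned≡   = ≡.refl
      ; increments≡ = ≡.refl
      }
      where
      covers : ∀ k → k ∈ undominatedBy h H₀ ⊎ Dominated k h
      covers k with dominated? k h
      ... | yes dom = inj₂ dom
      ... | no ¬dom = inj₁ (∈-filter⁺ (λ x → ¬? (dominated? x h)) (all∈ k) ¬dom)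
      -- h₁ is chosen among undominated packets only, but one of these is as heavy as h₀.
      wh≈wh₀ : w h ≈ w h₀
      wh≈wh₀ with y , undominated , wh₀≤wy ← heaviest-undominated h₀ (λ y → heaviest₀ y (all∈ y))
        = antisym (heaviest₀ h (all∈ h)) (≤-trans wh₀≤wy (proj₂ heaviest y (all∈ y , undominated)))
      wh/wh₀≈1 : w h / w h₀ ≈ 1#
      wh/wh₀≈1 = trans (*-congʳ wh≈wh₀) (*-inverseʳ _ (proj₂ (0<w h₀) ∘ sym))
      p₀≤0 : (1# - w h / w h₀) ⊓ 1# ≤ 0#
      p₀≤0 = ≤-trans (x⊓y≤x _ _) (≤-reflexive (trans (+-congˡ (-‿cong wh/wh₀≈1)) (-‿inverseʳ 1#)))
      r≈1 : 1# - (1# - w h / w h₀) ⊓ 1# ≈ 1#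
      r≈1 = trans (+-congˡ (-‿cong (antisym p₀≤0 (0≤q (≤-reflexive wh≈wh₀) 0≤1))))
        (solve 0 (:1 :- :0 := :1) refl)

  open LoopProperties public using (IsCost)

  ratio : ℕ → Carrier
  ratio N = 1# - (1# - 1# / fromℕ N) ^ N

  1/N-inUnitInterval : ∀ {N} → 1 ℕ.≤ N → InUnitInterval (1# / fromℕ N)
  1/N-inUnitInterval (ℕ.s≤s {n = n} _) =
    /-nonNegative 0≤1 (0<fromℕ-suc n) ,
    x≤y⇒x/y≤1 (0<fromℕ-suc n)
      (≤-by (fromℕ-nonNegative n) (solve 1 (λ x → (:1 :+ x) :- :1 := x) refl (fromℕ n)))

  N*1/N≈1 : ∀ {N} → 1 ℕ.≤ N → fromℕ N * (1# / fromℕ N) ≈ 1#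
  N*1/N≈1 (ℕ.s≤s {n = n} _) = trans (*-comm _ _) (x/y*y≈x 1# (fromℕ-suc≉0 n))

  0≤1-1/N : ∀ {N} → 1 ℕ.≤ N → 0# ≤ 1# - 1# / fromℕ N
  0≤1-1/N 1≤N = x≤y⇒0≤y-x (proj₂ (1/N-inUnitInterval 1≤N))

  0≤ratio : ∀ {N} → 1 ℕ.≤ N → 0# ≤ ratio N
  0≤ratio {N} 1≤N = x≤y⇒0≤y-x (^-≤1 N (0≤1-1/N 1≤N)
    (≤-by (proj₁ (1/N-inUnitInterval 1≤N)) (solve 1 (λ x → :1 :- (:1 :- x) := x) refl (1# / fromℕ N))))

  ratio≤1 : ∀ {N} → 1 ℕ.≤ N → ratio N ≤ 1#
  ratio≤1 {N} 1≤N = ≤-by (^-nonNegative N (0≤1-1/N 1≤N))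
    (solve 1 (λ x → :1 :- (:1 :- x) := x) refl ((1# - 1# / fromℕ N) ^ N))

  record IsProbability {a} {A : Set a} (D : Dist A) : Set (a ⊔ c ⊔ ℓ₁ ⊔ ℓ₂) where
    field
      nonNegative : All (λ (_ , p) → 0# ≤ p) D
      unitMass    : mass D ≈ 1#

  module _ {B : Buffer} (h₀ : Fin (length B)) (heaviest : MIXR.Heaviest B (_∈ allFin (length B)) h₀)
           (ex₀ : MIXR.Loop B (allFin (length B)) h₀ 1#) where

    open MIXR B using (w; assigned)
    open LoopProperties B hiding (IsCost)
    open FirstIteration (firstIteration ∈-allFin heaviest ex₀)

    private
      s = run h₀ heaviest ex₀
      D = take (positive ex) (assigned ex)

      transmission≡ : transmission s ≡ map (λ (i , p) → just i , p) D
      transmission≡ = ≡.cong (map _) (≡.cong₂ take increments≡ assigned≡)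

      0≤r : 0# ≤ r
      0≤r = ≤-respʳ (sym r≈1) 0≤1

      𝔼-transmission : ∀ X → 𝔼 X (transmission s) ≈ 𝔼 (X ∘ just) (assigned ex)
      𝔼-transmission X = trans (reflexive (≡.trans (≡.cong (𝔼 X) transmission≡) (𝔼-map X just D)))
        (𝔼-take (X ∘ just) (positive ex) (assigned ex) (assigned-drop bounded 0≤r ex))

      D-nonNegative : All (λ (_ , p) → 0# ≤ p) D
      D-nonNegative = All.take⁺ (positive ex) (All.map proj₁ (assigned-bounds bounded 0≤r ex))

      D-mass : mass D ≈ 1#
      D-mass = trans (𝔼-take _ (positive ex) (assigned ex) (assigned-drop bounded 0≤r ex))
        (trans (assigned-mass ex) r≈1)

    run-isProbability : IsProbability (transmission s)
    run-isProbability = record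
      { nonNegative = ≡.subst (All _) (≡.sym transmission≡) (All.map⁺ D-nonNegative)
      ; unitMass    = trans (𝔼-transmission _) (trans (assigned-mass ex) r≈1)
      }

    -- The probabilities p₁, ..., pₙ sum to 1 and n ≤ N, so AM-GM applies with mean 1/N to the
    -- product in `assigned-gain`.
    run-gain : ∀ {N} → 1 ℕ.≤ N → finalN s ℕ.≤ N →
               ratio N * w h ≤ 𝔼 (transmittedWeight B) (transmission s)
    run-gain {N} 1≤N n≤N = begin
      ratio N * w h                                      ≈⟨ *-comm _ _ ⟩
      w h * ratio N                                      ≤⟨ *-monoˡ-≤ (proj₁ (0<w h)) (≤-by (x≤y⇒0≤y-x Π≤)
                                                              (solve 2 (λ x y → (:1 :- x) :- (:1 :- y) := y :- x) refl _ _)) ⟩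
      w h * (1# - Π1- (map proj₂ (assigned ex)))         ≈⟨ assigned-gain bounded 0≤r ex ⟨
      𝔼 w (assigned ex)                                  ≈⟨ 𝔼-transmission _ ⟨
      𝔼 (transmittedWeight B) (transmission s)           ∎
      where
      open ≤-Reasoning poset
      length≤N : length (map proj₂ D) ℕ.≤ N
      length≤N = ℕ.≤-trans (ℕ.≤-reflexive (≡.trans (length-map proj₂ D) (length-take (positive ex) (assigned ex))))
        (ℕ.≤-trans (ℕ.m⊓n≤m _ _) (≡.subst (ℕ._≤ N) increments≡ n≤N))
      inUnitInterval : All InUnitInterval (map proj₂ D)
      inUnitInterval = All.map⁺ (All.zipWith (λ (0≤p , p≤mass) → 0≤p , ≤-respʳ D-mass p≤mass)
        (D-nonNegative , probabilities≤mass D-nonNegative))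
      Π≤ : Π1- (map proj₂ (assigned ex)) ≤ (1# - 1# / fromℕ N) ^ N
      Π≤ = ≤-respˡ (Π1-take (positive ex) (assigned ex) (assigned-drop bounded 0≤r ex))
        (am-gm N length≤N inUnitInterval (0≤1-1/N 1≤N)
          (trans (N*1/N≈1 1≤N) (trans (sym D-mass) (mass≈Σ D))))

    -- At h₁ the remaining probability is 1, so the bounds of `cost-pending` and `cost-dominated`
    -- both become w₁.
    run-cost : ∀ {k} {C : Transmission B → Carrier} → IsCost B k (C ∘ just) → 𝔼 C (transmission s) ≤ w h
    run-cost {k} {C} isCost = ≤-respˡ (sym (𝔼-transmission C)) (cost (covers k))
      where
      cost : k ∈ H ⊎ MIXR.Dominated B k h → 𝔼 (C ∘ just) (assigned ex) ≤ w h
      cost (inj₁ k∈H) = ≤-respʳ (trans (+-congˡ (-‿cong (*-congʳ (+-congˡ (-‿cong r≈1)))))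
          (solve 2 (λ h k → h :- (:1 :- :1) :* k := h) refl (w h) (w k)))
        (cost-pending isCost bounded 0≤r (≤-reflexive r≈1) ex k∈H)
      cost (inj₂ dom) = ≤-respʳ (trans (*-congˡ r≈1) (*-identityʳ _))
        (cost-dominated isCost bounded 0≤r ex dom)

  transmission-isProbability : ∀ {B} (s : Step B) → IsProbability (transmission s)
  transmission-isProbability idle                   = record
    { nonNegative = 0≤1 ∷ [] ; unitMass = solve 0 (:1 :* :1 :+ :0 := :1) refl }
  transmission-isProbability (run h₀ heaviest ex₀) = run-isProbability h₀ heaviest ex₀

  transmission-cost : ∀ {B} (s : Step B) {N} → 1 ℕ.≤ N → finalN s ℕ.≤ N →
                      ∀ {k} {C : Transmission B → Carrier} → IsCost B k (C ∘ just) →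
                      ratio N * 𝔼 C (transmission s) ≤ 𝔼 (transmittedWeight B) (transmission s)
  transmission-cost idle                  _   _   {()}
  transmission-cost (run h₀ heaviest ex₀) 1≤N n≤N isCost = ≤-trans
    (*-monoˡ-≤ (0≤ratio 1≤N) (run-cost h₀ heaviest ex₀ isCost)) (run-gain h₀ heaviest ex₀ 1≤N n≤N)

-- Locating list elements up to permutation.

module _ {a b} {A : Set a} {B : Set b} (f : A → Maybe B) where

  -- Finds the slot that holds a given packet and brings it to the front.
  ∈-mapMaybe⁻ : ∀ {y} xs → y ∈ mapMaybe f xs → ∃₂ λ x xs′ → xs ↭ x ∷ xs′ × f x ≡ just y
  ∈-mapMaybe⁻ (x ∷ xs) y∈ with f x in fx≡
  ∈-mapMaybe⁻ (x ∷ xs) (here ≡.refl) | just _ = x , xs , ↭-refl , fx≡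
  ∈-mapMaybe⁻ (x ∷ xs) (there y∈) | just _
    with x′ , xs′ , xs↭ , fx′≡ ← ∈-mapMaybe⁻ xs y∈ = x′ , x ∷ xs′ , ↭-trans (prep x xs↭) (swap x x′ ↭-refl) , fx′≡
  ∈-mapMaybe⁻ (x ∷ xs) y∈ | nothing
    with x′ , xs′ , xs↭ , fx′≡ ← ∈-mapMaybe⁻ xs y∈ = x′ , x ∷ xs′ , ↭-trans (prep x xs↭) (swap x x′ ↭-refl) , fx′≡

  mapMaybe->>= : ∀ {c} {C : Set c} (g : B → Maybe C) xs → mapMaybe (λ x → f x >>= g) xs ≡ mapMaybe g (mapMaybe f xs)
  mapMaybe->>= g []       = ≡.refl
  mapMaybe->>= g (x ∷ xs) with f x
  ... | nothing = mapMaybe->>= g xs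
  ... | just y  with g y
  ...   | nothing = mapMaybe->>= g xs
  ...   | just z  = ≡.cong (z ∷_) (mapMaybe->>= g xs)

removeAt-↭ : ∀ {a} {A : Set a} (xs : List A) i → xs ↭ lookup xs i ∷ removeAt xs i
removeAt-↭ (x ∷ xs) zero    = ↭-refl
removeAt-↭ (x ∷ xs) (suc i) = ↭-trans (prep x (removeAt-↭ xs i)) (swap x (lookup xs i) ↭-refl)

-- Couplings of the two buffers and their potential.

module Couplings {c ℓ₁ ℓ₂} (F : OrderedField c ℓ₁ ℓ₂) where

  open OrderedField F
  open OrderedFieldProperties F
  open Expectation F
  open StepAnalysis F
  open Solver
  open Game F
  open Packet

  -- With 0 for a missing packet, an unmatched ADV packet carries its full weight as credit and an
  -- unmatched packet of MIX-R carries none.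
  weightOf : Maybe Packet → Carrier
  weightOf = maybe weight 0#

  Fits : Maybe Packet → Maybe Packet → Set
  Fits nothing  _        = ⊤
  Fits (just a) nothing  = ⊤
  Fits (just a) (just b) = deadline a ℕ.≤ deadline b

  fits-nothing : ∀ m → Fits m nothing
  fits-nothing nothing  = tt
  fits-nothing (just _) = tt

  fits-mono : ∀ m {a b} → Fits m (just a) → deadline a ℕ.≤ deadline b → Fits m (just b)
  fits-mono nothing  _   _   = tt
  fits-mono (just _) m≤a a≤b = ℕ.≤-trans m≤a a≤b

  fits-age : ∀ m n → Fits m n → Fits (m >>= age) (n >>= age)
  fits-age nothing                              _                           _   = tt
  fits-age (just (packet _ 0             _ _)) _                           _   = tt
  fits-age (just (packet _ 1             _ _)) _                           _   = tt
  fits-age (just (packet _ (suc (suc _)) _ _)) nothing                     _   = tt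
  -- In the two absurd cases the partner would expire while ADV's packet survives.
  fits-age (just (packet _ (suc (suc _)) _ _)) (just (packet _ 0 _ _))     ()
  fits-age (just (packet _ (suc (suc _)) _ _)) (just (packet _ 1 _ _))     (ℕ.s≤s ())
  fits-age (just (packet _ (suc (suc _)) _ _)) (just (packet _ (suc (suc _)) _ _)) m≤n = ℕ.≤-pred m≤n

  -- Either side may be missing, so that unmatched packets of both parties have slots too.
  record Slot : Set (c ⊔ ℓ₁ ⊔ ℓ₂) where
    constructor slot
    field
      adv alg : Maybe Packet
      fits    : Fits adv alg

  open Slot

  credit : Slot → Carrier
  credit σ = (weightOf (adv σ) - weightOf (alg σ)) ⁺

  Φ : List Slot → Carrier
  Φ = foldr (λ σ acc → credit σ + acc) 0#

  Φ-++ : ∀ S T → Φ (S ++ T) ≈ Φ S + Φ T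
  Φ-++ []      T = sym (+-identityˡ _)
  Φ-++ (σ ∷ S) T = trans (+-congˡ (Φ-++ S T)) (sym (+-assoc _ _ _))

  Φ-↭ : ∀ {S T} → S ↭ T → Φ S ≈ Φ T
  Φ-↭ ↭.refl          = refl
  Φ-↭ (prep σ S↭T)    = +-congˡ (Φ-↭ S↭T)
  Φ-↭ (swap σ τ S↭T)  = trans (+-congˡ (+-congˡ (Φ-↭ S↭T)))
    (solve 3 (λ x y z → x :+ (y :+ z) := y :+ (x :+ z)) refl (credit σ) (credit τ) _)
  Φ-↭ (↭.trans p q)   = trans (Φ-↭ p) (Φ-↭ q)

  Φ-nonNegative : ∀ S → 0# ≤ Φ S
  Φ-nonNegative []      = ≤-refl
  Φ-nonNegative (σ ∷ S) = +-nonNegative (0≤x⁺ _) (Φ-nonNegative S)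

  0≤weight : ∀ a → 0# ≤ weight a
  0≤weight a = proj₁ (0<weight a)

  0≤weightOf : ∀ m → 0# ≤ weightOf m
  0≤weightOf nothing  = ≤-refl
  0≤weightOf (just a) = 0≤weight a

  credit-nothing : ∀ m → (0# - weightOf m) ⁺ ≤ 0#
  credit-nothing m = ⁺-least (≤-by (0≤weightOf m) (solve 1 (λ x → :0 :- (:0 :- x) := x) refl (weightOf m))) ≤-refl

  ageSlot : Slot → Slot
  ageSlot (slot v a fits) = slot (v >>= age) (a >>= age) (fits-age v a fits)

  -- If ADV's packet expires, its credit falls to 0. Otherwise its partner, if any, survives as
  -- well, and the credit is unchanged.
  credit-age : ∀ σ → credit (ageSlot σ) ≤ credit σ
  credit-age (slot nothing a _) = ≤-trans (credit-nothing (a >>= age)) (0≤x⁺ _)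
  credit-age (slot (just (packet _ 0 _ _)) a _) = ≤-trans (credit-nothing (a >>= age)) (0≤x⁺ _)
  credit-age (slot (just (packet _ 1 _ _)) a _) = ≤-trans (credit-nothing (a >>= age)) (0≤x⁺ _)
  credit-age (slot (just (packet _ (suc (suc _)) _ _)) nothing _) = ≤-refl
  credit-age (slot (just (packet _ (suc (suc _)) _ _)) (just (packet _ 1 _ _)) (ℕ.s≤s ()))
  credit-age (slot (just (packet _ (suc (suc _)) _ _)) (just (packet _ (suc (suc _)) _ _)) _) = ≤-refl

  Φ-age : ∀ S → Φ (map ageSlot S) ≤ Φ S
  Φ-age []      = ≤-refl
  Φ-age (σ ∷ S) = +-mono-≤ (credit-age σ) (Φ-age S)

  -- An injected packet enters both buffers and is matched with its own copy, at credit 0.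
  twin : Packet → Slot
  twin a = slot (just a) (just a) ℕ.≤-refl

  Φ-twins : ∀ B → Φ (map twin B) ≤ 0#
  Φ-twins []      = ≤-refl
  Φ-twins (a ∷ B) = ≤-respʳ (+-identityˡ 0#)
    (+-mono-≤ (⁺-least (≤-reflexive (-‿inverseʳ (weight a))) ≤-refl) (Φ-twins B))

  record Coupling (A V : Buffer) : Set (c ⊔ ℓ₁ ⊔ ℓ₂) where
    field
      slots : List Slot
      alg-↭ : mapMaybe alg slots ↭ A
      adv-↭ : mapMaybe adv slots ↭ V

  open Coupling

  potential : ∀ {A V} → Coupling A V → Carrier
  potential κ = Φ (slots κ)

  twins : ∀ B → Coupling B B
  twins B = record
    { slots = map twin B
    ; alg-↭ = ↭-reflexive (mapMaybe-map-retract (λ _ → ≡.refl) B)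
    ; adv-↭ = ↭-reflexive (mapMaybe-map-retract (λ _ → ≡.refl) B)
    }

  project-renewed : ∀ (f : Slot → Maybe Packet) → (∀ σ → f (ageSlot σ) ≡ (f σ >>= age)) → (∀ a → f (twin a) ≡ just a) →
                    ∀ {B} S I → mapMaybe f S ↭ B → mapMaybe f (map ageSlot S ++ map twin I) ↭ mapMaybe age B ++ I
  project-renewed f f-age f-twin S I S↭B = ↭-trans (↭-reflexive eq) (++⁺ʳ I (mapMaybe-↭ age S↭B))
    where
    eq : mapMaybe f (map ageSlot S ++ map twin I) ≡ mapMaybe age (mapMaybe f S) ++ I
    eq = ≡.trans (mapMaybe-++ f (map ageSlot S) (map twin I))
      (≡.cong₂ _++_
        (≡.trans (mapMaybe-map f ageSlot S) (≡.trans (mapMaybe-cong f-age S) (mapMaybe->>= f age S)))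
        (mapMaybe-map-retract f-twin I))

  renew : ∀ {A V} (I : List Packet) → Coupling A V → Coupling (mapMaybe age A ++ I) (mapMaybe age V ++ I)
  renew I κ = record
    { slots = map ageSlot (slots κ) ++ map twin I
    ; alg-↭ = project-renewed alg (λ _ → ≡.refl) (λ _ → ≡.refl) (slots κ) I (alg-↭ κ)
    ; adv-↭ = project-renewed adv (λ _ → ≡.refl) (λ _ → ≡.refl) (slots κ) I (adv-↭ κ)
    }

  potential-renew : ∀ {A V} I (κ : Coupling A V) → potential (renew I κ) ≤ potential κ
  potential-renew I κ = ≤-respˡ (sym (Φ-++ (map ageSlot (slots κ)) (map twin I)))
    (≤-respʳ (solve 1 (λ x → x :+ :0 := x) refl _) (+-mono-≤ (Φ-age (slots κ)) (Φ-twins I)))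

  -- After ADV's transmission y: the slots without that of the transmitted
  -- packet, whose partner is set aside.
  record Freed (A V : Buffer) (y : Transmission V) : Set (c ⊔ ℓ₁ ⊔ ℓ₂) where
    constructor freed
    field
      partner : Maybe Packet
      rest    : List Slot
      alg-↭   : catMaybes (partner ∷ map alg rest) ↭ A
      adv-↭   : mapMaybe adv rest ↭ remove V y

  -- The slot given up held credit at least `weight a - weightOf m`, so this credit and the weight
  -- of the freed partner together pay for ADV's gain.
  free : ∀ {A V} (κ : Coupling A V) (y : Transmission V) →
         ∃ λ (φ : Freed A V y) → transmittedWeight V y + Φ (Freed.rest φ) ≤ potential κ + weightOf (Freed.partner φ)
  free κ nothing = freed nothing (slots κ) (alg-↭ κ) (adv-↭ κ) ,
    ≤-reflexive (solve 1 (λ x → :0 :+ x := x :+ :0) refl _)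
  free {V = V} κ (just i)
    with slot (just a) m fits , rest , S↭ , ≡.refl ← ∈-mapMaybe⁻ adv (slots κ)
           (∈-resp-↭ (↭-sym (↭-trans (adv-↭ κ) (removeAt-↭ V i))) (here ≡.refl))
    = freed m rest (↭-trans (↭-sym (mapMaybe-↭ alg S↭)) (alg-↭ κ))
        (drop-∷ (↭-trans (↭-sym (mapMaybe-↭ adv S↭)) (↭-trans (adv-↭ κ) (removeAt-↭ V i)))) ,
      ≤-respʳ (+-congʳ (sym (Φ-↭ S↭)))
        (≤-by (x≤y⇒0≤y-x (x≤x⁺ (weight a - weightOf m)))
          (solve 4 (λ x p a m → ((p :+ x) :+ m) :- (a :+ x) := p :- (a :- m)) refl
            (Φ rest) ((weight a - weightOf m) ⁺) (weight a) (weightOf m)))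

  -- Bounds the new credit when MIX-R transmits f while b is free: the ADV packet that loses f
  -- either takes b instead or is credited with the whole weight of f.
  extra : Maybe Packet → Packet → Carrier
  extra nothing  f = weight f
  extra (just b) f with deadline f ℕ.≤? deadline b
  ... | yes _ = (weight f - weight b) ⁺
  ... | no  _ = weight f

  0≤extra : ∀ m f → 0# ≤ extra m f
  0≤extra nothing  f = 0≤weight f
  0≤extra (just b) f with deadline f ℕ.≤? deadline b
  ... | yes _ = 0≤x⁺ _
  ... | no  _ = 0≤weight f

  credit-unmatched : ∀ m f → (weightOf m - 0#) ⁺ ≤ (weightOf m - weight f) ⁺ + weight f
  credit-unmatched m f = ≤-trans (⁺-triangle (weightOf m) (weight f) 0#)
    (+-mono-≤ ≤-refl (⁺-least (≤-reflexive (solve 1 (λ x → x :- :0 := x) refl _)) (0≤weight f)))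

  rematch : ∀ {A V y} (φ : Freed A V y) (i : Fin (length A)) →
            ∃ λ (κ : Coupling (removeAt A i) (remove V y)) →
              potential κ ≤ Φ (Freed.rest φ) + extra (Freed.partner φ) (lookup A i)
  rematch {A} (freed nothing rest alg-↭ adv-↭) i
    with slot v (just f) fits , S , rest↭ , ≡.refl ← ∈-mapMaybe⁻ alg rest
           (∈-resp-↭ (↭-sym (↭-trans alg-↭ (removeAt-↭ A i))) (here ≡.refl))
    = record
      { slots = slot v nothing (fits-nothing v) ∷ S
      ; alg-↭ = drop-∷ (↭-trans (↭-sym (mapMaybe-↭ alg rest↭)) (↭-trans alg-↭ (removeAt-↭ A i)))
      ; adv-↭ = ↭-trans (↭-sym (mapMaybe-↭ adv rest↭)) adv-↭
      } ,
      ≤-respʳ (+-congʳ (sym (Φ-↭ rest↭)))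
        (≤-respʳ (solve 3 (λ x s f → x :+ f :+ s := x :+ s :+ f) refl _ _ _) (+-monoˡ-≤ (Φ S) (credit-unmatched v f)))
  rematch {A} (freed (just b) rest alg-↭ adv-↭) i
    with ∈-resp-↭ (↭-sym (↭-trans alg-↭ (removeAt-↭ A i))) (here ≡.refl)
  -- MIX-R transmits the freed partner itself, and no ADV packet loses its match.
  ... | here ≡.refl = record
      { slots = rest
      ; alg-↭ = drop-∷ (↭-trans alg-↭ (removeAt-↭ A i))
      ; adv-↭ = adv-↭
      } ,
      ≤-by (0≤extra (just b) b) (solve 2 (λ x e → (x :+ e) :- x := e) refl (Φ rest) _)
  ... | there f∈
    with slot v (just f) fits , S , rest↭ , ≡.refl ← ∈-mapMaybe⁻ alg rest f∈
    with b∷S↭ ← drop-∷ (↭-trans (swap f b ↭-refl)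
           (↭-trans (prep b (↭-sym (mapMaybe-↭ alg rest↭))) (↭-trans alg-↭ (removeAt-↭ A i))))
    -- v expires no later than f, so b may replace f if f expires no later than b. Otherwise b and v
    -- get separate slots.
    with deadline f ℕ.≤? deadline b
  ...   | yes f≤b = record
      { slots = slot v (just b) (fits-mono v fits f≤b) ∷ S
      ; alg-↭ = b∷S↭
      ; adv-↭ = ↭-trans (↭-sym (mapMaybe-↭ adv rest↭)) adv-↭
      } ,
      ≤-respʳ (+-congʳ (sym (Φ-↭ rest↭)))
        (≤-respʳ (solve 3 (λ x s f → x :+ f :+ s := x :+ s :+ f) refl _ _ _)
          (+-monoˡ-≤ (Φ S) (⁺-triangle (weightOf v) (weight f) (weight b))))
  ...   | no _ = record
      { slots = slot nothing (just b) tt ∷ slot v nothing (fits-nothing v) ∷ S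
      ; alg-↭ = b∷S↭
      ; adv-↭ = ↭-trans (↭-sym (mapMaybe-↭ adv rest↭)) adv-↭
      } ,
      ≤-respʳ (+-congʳ (sym (Φ-↭ rest↭)))
        (≤-respʳ (solve 3 (λ x s f → :0 :+ (x :+ f :+ s) := x :+ s :+ f) refl _ _ _)
          (+-mono-≤ (credit-nothing (just b)) (+-monoˡ-≤ (Φ S) (credit-unmatched v f))))

  unsent : ∀ {A V y} → Freed A V y → Coupling A (remove V y)
  unsent (freed partner rest alg-↭ adv-↭) = record
    { slots = slot nothing partner tt ∷ rest ; alg-↭ = alg-↭ ; adv-↭ = adv-↭ }

  transmit : ∀ {A V y} → Freed A V y → (x : Transmission A) → Coupling (remove A x) (remove V y)
  transmit φ nothing  = unsent φ
  transmit φ (just i) = proj₁ (rematch φ i)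

  cost : ∀ {A V y} → Freed A V y → Transmission A → Carrier
  cost {A} φ = maybe (λ i → weightOf (Freed.partner φ) + extra (Freed.partner φ) (lookup A i)) (weightOf (Freed.partner φ))

  transmit-cost : ∀ {A V y} (φ : Freed A V y) x →
                  potential (transmit φ x) + weightOf (Freed.partner φ) ≤ Φ (Freed.rest φ) + cost φ x
  transmit-cost φ nothing  = +-monoˡ-≤ _ (≤-respʳ (+-identityˡ _) (+-monoˡ-≤ _ (credit-nothing (Freed.partner φ))))
  transmit-cost φ (just i) = ≤-respʳ (solve 3 (λ r e w → r :+ e :+ w := r :+ (w :+ e)) refl _ _ _)
    (+-monoˡ-≤ _ (proj₂ (rematch φ i)))

  -- With rematching the cost is `w k` plus the positive part of `w i - w k`, which is the larger of
  -- the two weights. Without it the cost is their sum, and the premise of `≤-max` excludes this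
  -- case.
  extra-isCost : ∀ {A} k → IsCost A k (λ i → weight (lookup A k) + extra (just (lookup A k)) (lookup A i))
  extra-isCost {A} k = record { ≤-sum = ≤-sum ; ≤-max = ≤-max }
    where
    open MIXR A
    ≤-sum : ∀ i → w k + extra (just (lookup A k)) (lookup A i) ≤ w i + w k
    ≤-sum i with d i ℕ.≤? d k
    ... | no  _ = ≤-reflexive (+-comm _ _)
    ... | yes _ = ≤-respʳ (+-comm _ _) (+-mono-≤ ≤-refl (⁺-least
      (≤-by (0≤weight (lookup A k)) (solve 2 (λ i k → i :- (i :- k) := k) refl (w i) (w k)))
      (0≤weight (lookup A i))))
    ≤-max : ∀ i {v} → d i ℕ.≤ d k → w i ≤ v → w k ≤ v → w k + extra (just (lookup A k)) (lookup A i) ≤ v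
    ≤-max i {v} di≤dk wi≤v wk≤v with d i ℕ.≤? d k
    ... | no  di≰dk = contradiction di≤dk di≰dk
    ... | yes _     = ≤-respʳ (solve 2 (λ k v → k :+ (v :- k) := v) refl (w k) v) (+-mono-≤ ≤-refl (⁺-least
      (+-monoˡ-≤ _ wi≤v) (x≤y⇒0≤y-x wk≤v)))

  0≤transmittedWeight : ∀ B x → 0# ≤ transmittedWeight B x
  0≤transmittedWeight B nothing  = ≤-refl
  0≤transmittedWeight B (just i) = 0≤weight (lookup B i)

  -- If no partner is freed, the cost is the weight that MIX-R transmits, and `ratio N` ≤ 1
  -- suffices. A freed partner is pending for MIX-R and becomes the packet k of the step analysis.
  expected-cost : ∀ {A V y} (s : Step A) {N} → 1 ℕ.≤ N → finalN s ℕ.≤ N → (φ : Freed A V y) →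
                  ratio N * 𝔼 (cost φ) (transmission s) ≤ 𝔼 (transmittedWeight A) (transmission s)
  expected-cost {A} s {N} 1≤N n≤N φ@(freed nothing _ _ _) = begin
    ratio N * 𝔼 (cost φ) (transmission s)  ≈⟨ *-congˡ (𝔼-cong cost≈ (transmission s)) ⟩
    ratio N * g                            ≤⟨ *-mono-≤ 0≤g 0≤1 (ratio≤1 1≤N) ≤-refl ⟩
    1# * g                                 ≈⟨ *-identityˡ g ⟩
    g                                      ∎
    where
    open ≤-Reasoning poset
    g = 𝔼 (transmittedWeight A) (transmission s)
    cost≈ : ∀ x → cost φ x ≈ transmittedWeight A x
    cost≈ nothing  = refl
    cost≈ (just i) = +-identityˡ _
    0≤g : 0# ≤ g
    0≤g = ≤-respˡ (trans (𝔼-const 0# (transmission s)) (zeroˡ _)) (𝔼-mono (All.map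
      (λ {(x , _)} 0≤p → 0≤p , λ _ → 0≤transmittedWeight A x)
      (IsProbability.nonNegative (transmission-isProbability s))))
  expected-cost {A} s 1≤N n≤N (freed (just b) _ alg-↭ _)
    with b∈A ← ∈-resp-↭ alg-↭ (here ≡.refl)
    with index b∈A | lookup-index b∈A
  ... | k | ≡.refl = transmission-cost s 1≤N n≤N (extra-isCost k)

-- The potential argument over a whole play.

module Competitiveness {c ℓ₁ ℓ₂} (F : OrderedField c ℓ₁ ℓ₂)
  (mixR : Game.MIX-R F) (adversary : Game.Adversary F) where

  open OrderedField F
  open OrderedFieldProperties F
  open Expectation F
  open StepAnalysis F
  open Couplings F
  open Solver
  open Game F
  open Play mixR adversary
  open Adversary adversary
  open State

  CoupledState : Set _
  CoupledState = ∃ λ s → Coupling (algBuffer s) (advBuffer s)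

  -- Determined before MIX-R's random choice: ADV answers without seeing it, so k is fixed while the
  -- expectation over the transmission is taken.
  freeing : ((s , _) : CoupledState) → Freed (algBuffer s) (advBuffer s) (answer (history s) (advBuffer s))
  freeing (s , κ) = proj₁ (free κ (answer (history s) (advBuffer s)))

  coupledNext : ((s , κ) : CoupledState) → Transmission (algBuffer s) → CoupledState
  coupledNext z@(s , κ) x = next s x , renew (inject (history (next s x))) (transmit (freeing z) x)

  -- Each outcome carries its coupling, which results from the rematchings made along the way.
  coupledPlay : ℕ → Dist CoupledState
  coupledPlay zero    = ((initial , twins (inject [])) , 1#) ∷ []
  coupledPlay (suc t) = concatMap
    (λ (z , p) → map (λ (x , q) → coupledNext z x , p * q) (transmission (algStep (proj₁ z))))
    (coupledPlay t)

  forget : CoupledState × Carrier → State × Carrier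
  forget ((s , _) , p) = s , p

  forget-coupledPlay : ∀ t → map forget (coupledPlay t) ≡ play t
  forget-coupledPlay zero    = ≡.refl
  forget-coupledPlay (suc t) = ≡.trans (map-concatMap forget _ (coupledPlay t))
    (≡.trans (concatMap-cong (λ (z , p) → ≡.sym (map-∘ (transmission (algStep (proj₁ z))))) (coupledPlay t))
      (≡.trans (≡.sym (concatMap-map _ forget (coupledPlay t))) (≡.cong (concatMap _) (forget-coupledPlay t))))

  coupledPlay-nonNegative : ∀ t → All (λ (_ , p) → 0# ≤ p) (coupledPlay t)
  coupledPlay-nonNegative zero    = 0≤1 ∷ []
  coupledPlay-nonNegative (suc t) = All.concat⁺ (All.map⁺ (All.map
    (λ {(z , _)} 0≤p → All.map⁺ (All.map (*-nonNegative 0≤p)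
      (IsProbability.nonNegative (transmission-isProbability (algStep (proj₁ z))))))
    (coupledPlay-nonNegative t)))

  module _ {N} (1≤N : 1 ℕ.≤ N) (isMaxN : IsMaxN N) where

    -- MIX-R's gain less the required share of ADV's gain and outstanding credit. It starts at a
    -- nonnegative value and is a submartingale.
    surplus : CoupledState → Carrier
    surplus (s , κ) = algGain s - ratio N * (advGain s + potential κ)

    surplus-next : ∀ z x → let s = proj₁ z in
      surplus z + (transmittedWeight (algBuffer s) x - ratio N * cost (freeing z) x) ≤ surplus (coupledNext z x)
    surplus-next z@(s , κ) x = ≤-by (*-nonNegative (0≤ratio 1≤N) (x≤y⇒0≤y-x advStep≤))
      (solve 8 (λ g r v P a c w P′ → ((g :+ a) :- r :* ((v :+ w) :+ P′)) :- ((g :- r :* (v :+ P)) :+ (a :- r :* c))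
                                    := r :* ((P :+ c) :- (w :+ P′))) refl
        (algGain s) (ratio N) (advGain s) (potential κ) (transmittedWeight (algBuffer s) x) (cost φ x) wy
        (potential (proj₂ (coupledNext z x))))
      where
      φ = freeing z
      y = answer (history s) (advBuffer s)
      wy = transmittedWeight (advBuffer s) y
      m = weightOf (Freed.partner φ)
      -- The bounds from `free` and `transmit-cost` add up: the partner's weight and the potential
      -- of the remaining slots cancel, and renewal does not raise the potential.
      advStep≤ : wy + potential (proj₂ (coupledNext z x)) ≤ potential κ + cost φ x
      advStep≤ = ≤-trans (+-mono-≤ ≤-refl (potential-renew _ (transmit φ x)))
        (≤-by (+-nonNegative (x≤y⇒0≤y-x (proj₂ (free κ y))) (x≤y⇒0≤y-x (transmit-cost φ x)))
          (solve 6 (λ P c w T m R → (P :+ c) :- (w :+ T) := ((P :+ m) :- (w :+ R)) :+ ((R :+ c) :- (T :+ m))) refl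
            (potential κ) (cost φ x) wy (potential (transmit φ x)) m (Φ (Freed.rest φ))))

    surplus-step : ∀ z → finalN (algStep (proj₁ z)) ℕ.≤ N →
                   surplus z ≤ 𝔼 (surplus ∘ coupledNext z) (transmission (algStep (proj₁ z)))
    surplus-step z@(s , _) n≤N = ≤-trans
      (≤-by (x≤y⇒0≤y-x (expected-cost (algStep s) 1≤N n≤N φ))
        (trans (+-congʳ linear) (solve 4 (λ z g r c → (z :+ (g :- r :* c)) :- z := g :- r :* c) refl (surplus z) _ _ _)))
      (𝔼-mono (All.map (λ {(x , _)} 0≤p → 0≤p , λ _ → surplus-next z x) nonNegative))
      where
      φ = freeing z
      T = transmission (algStep s)
      open IsProbability (transmission-isProbability (algStep s))
      g = transmittedWeight (algBuffer s)
      linear : 𝔼 (λ x → surplus z + (g x - ratio N * cost φ x)) T ≈ surplus z + (𝔼 g T - ratio N * 𝔼 (cost φ) T)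
      linear = trans (𝔼-+ (λ _ → surplus z) _ T) (+-cong
        (trans (𝔼-const (surplus z) T) (trans (*-congˡ unitMass) (*-identityʳ _)))
        (𝔼-minus g (cost φ) (ratio N) T))

    0≤𝔼surplus : ∀ t → 0# ≤ 𝔼 surplus (coupledPlay t)
    0≤𝔼surplus zero    = ≤-by (*-nonNegative (0≤ratio 1≤N) (x≤y⇒0≤y-x (Φ-twins (inject []))))
      (solve 2 (λ r P → (:1 :* (:0 :- r :* (:0 :+ P)) :+ :0) :- :0 := r :* (:0 :- P)) refl
        (ratio N) (Φ (map twin (inject []))))
    0≤𝔼surplus (suc t) = ≤-trans (0≤𝔼surplus t) (≤-respʳ
      (sym (𝔼-bind surplus coupledNext (transmission ∘ algStep ∘ proj₁) (coupledPlay t)))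
      -- Positive probability shows that the underlying state occurs, whence n ≤ N there.
      (𝔼-mono (All.tabulate λ {(z , p)} z∈ → All.lookup (coupledPlay-nonNegative t) z∈ , λ 0<p →
        surplus-step z (proj₂ isMaxN t (proj₁ z)
          (p , ≡.subst (_ ∈_) (forget-coupledPlay t) (∈-map⁺ forget z∈) , 0<p)))))

    competitive : ∀ t → ratio N * 𝔼advGain t ≤ 𝔼algGain t
    competitive t = 0≤y-x⇒x≤y (≤-trans (0≤𝔼surplus t) (≤-respʳ eq (𝔼-mono (All.map
      (λ {((s , κ) , _)} 0≤p → 0≤p , λ _ → ≤-by (*-nonNegative (0≤ratio 1≤N) (Φ-nonNegative (Coupling.slots κ)))
        (solve 4 (λ a r v P → (a :- r :* v) :- (a :- r :* (v :+ P)) := r :* P) refl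
          (algGain s) (ratio N) (advGain s) (potential κ)))
      (coupledPlay-nonNegative t)))))
      where
      𝔼-forget : ∀ X → 𝔼 (X ∘ proj₁) (coupledPlay t) ≈ 𝔼 X (play t)
      𝔼-forget X = reflexive (≡.trans (≡.sym (𝔼-map X proj₁ (coupledPlay t))) (≡.cong (𝔼 X) (forget-coupledPlay t)))
      eq : 𝔼 (λ (s , _) → algGain s - ratio N * advGain s) (coupledPlay t) ≈ 𝔼algGain t - ratio N * 𝔼advGain t
      eq = trans (𝔼-minus (algGain ∘ proj₁) (advGain ∘ proj₁) (ratio N) (coupledPlay t))
        (+-cong (𝔼-forget algGain) (-‿cong (*-congˡ (𝔼-forget advGain))))

theorem4 : ∀ {c ℓ₁ ℓ₂} (F : OrderedField c ℓ₁ ℓ₂) →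
    let open OrderedField F
        open Game F in
    (mixR : MIX-R) (adversary : Adversary) →
    let open Play mixR adversary in
    (N : ℕ) → 1 ℕ.≤ N → IsMaxN N →
    (λ t → (1# - (1# - 1# / fromℕ N) ^ N) * 𝔼advGain t) ≤sup 𝔼algGain
-- The gains compare at every single horizon, which is stronger than comparing suprema.
theorem4 F mixR adversary N 1≤N isMaxN u alg≤u t = ≤-trans (competitive 1≤N isMaxN t) (alg≤u t)
  where
  open Competitiveness F mixR adversary
  open OrderedFieldProperties F using (≤-trans)
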